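{- Let $p$ be an odd prime number and $a\in\mathbb{Z}_{\geq1}$ with $\gcd(a,p)=1$. Put $\tau_{p}(a):=\sum_{j=1}^{p-1} j\,p^{ja-1}$. Then \[ b_{\tau_{p}(a)}(a^{ -1}) \equiv \left( \frac{ -2}{p} \right) \left( \frac{p-1}{2} \right)! \pmod{p}. \]
   Context: $b_n(x)=\sum_{j\ge0}S(n,j)x^j\in\mathbb{Z}[x]$ is the Bell polynomial, where $S(n,j)$ is the Stirling number of the second kind. $a^{ -1}$ denotes the inverse of $a$ modulo $p$ and the left side is evaluated in $\mathbb{F}_p$. $\left(\frac{*}{p}\right)$ is the Legendre symbol. -}

module Defs where

open import Data.Nat using (ℕ; zero; suc; _+_; _*_; _∸_; _^_; _≡ᵇ_; _%_)
open import Data.Bool using (Bool; true; false; _∨_; if_then_else_)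
open import Data.Integer as ℤ using (ℤ; +_; _%ℕ_)

stirling2 : ℕ → ℕ → ℕ
stirling2 zero    zero    = 1
stirling2 zero    (suc k) = 0
stirling2 (suc n) zero    = 0
stirling2 (suc n) (suc k) = suc k * stirling2 n (suc k) + stirling2 n k

sumTo : ℕ → (ℕ → ℕ) → ℕ
sumTo zero    f = f 0
sumTo (suc m) f = sumTo m f + f (suc m)

-- Bell polynomial b_n(x) = Σ_{j≥0} S(n,j) x^j (S(n,j)=0 for j>n), evaluated at x ∈ ℕ.
bell : ℕ → ℕ → ℕ
bell n x = sumTo n (λ j → stirling2 n j * x ^ j)

-- τ_p(a) = Σ_{j=1}^{p-1} j p^{ja-1}   (the j = 0 term is 0)
tau : ℕ → ℕ → ℕ
tau p a = sumTo (p ∸ 1) (λ j → j * p ^ (j * a ∸ 1))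

private
  sqSearch : ℕ → ℕ → ℕ → Bool
  sqSearch q r zero    = false
  sqSearch q r (suc m) = ((m * m) % suc q ≡ᵇ r) ∨ sqSearch q r m

legendre : ℤ → ℕ → ℤ
legendre d zero    = + 0
legendre d (suc q) with d %ℕ suc q
... | zero  = + 0
... | suc r = if sqSearch q (suc r) (suc q) then + 1 else ℤ.- (+ 1)

{-# OPTIONS --safe #-}
module Submission where

-- For c in a ring B of characteristic p and y ∈ B with y^p = y + c, the functional
-- L : x^n ↦ b_n(c), characterised by L(x f(x)) = c L(f(x + 1)) and L(1) = 1, has the trace formula
--   Q(y) L(f) = Σ_{i ∈ F_p} P(y + i) f((y + i)^p),   P(y) = Π_{0<j<p} (y + j)^{p-j},   Q(y) = Σ_i P(y + i),
-- because P(y + 1) (y + 1)^p = c P(y).  If f(x^p) = Π_{j<p} (x + j)^j on the orbit of y, the right-hand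
-- side is Σ_i Π_{0<j<p} (y + i + j)^p = -1.  For B = F_p[y], f = Π (x - c + j)^j shows that Q is a unit,
-- hence a constant.  For B = F_p[y]/(y^p - y - a⁻¹), Frobenius turns f = x^τ into such an f; for
-- B = F_p[y]/(y^p - y), L is evaluation at 0 and f = Π (x + j)^j is such an f.  Hence
-- b_τ(a⁻¹) = Π_{j<p} j^j, and pairing j with p - j, together with Euler's criterion for -2,
-- evaluates this product.

-- The obstacle is the factor Q: P has degree p(p - 1)/2, and no closed form of Q is at hand. In
-- F_p[y] with c = y^p - y the relation y^p = y + c holds by construction while y stays free, so
-- that Q is found to be constant as a polynomial. One scalar k then represents Q in every quotient
-- F_p[y]/(y^p - y - c), and values found in different quotients become comparable: b_τ(a⁻¹) and Π
-- j^j both solve k z = -1. Such an equation descends from the quotient to F_p because nonzero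
-- multiples of y^p - y - c are never constant.
--
-- P comes from solving P(y + 1) (y + 1)^p = c P(y): on the orbit c = y^p - y is the rising
-- factorial (y + 1)...(y + p), and the product of all shorter rising factorials is a solution.
--
-- The quotient for c = 0 has zero divisors, since y^p - y splits. The arguments in characteristic p
-- are therefore made for arbitrary commutative rings and divide only by the images of 1, ..., p -
-- 1, which Bézout makes invertible.

open import Defs
open import Algebra.Bundles using (CommutativeRing)
open import Data.Bool.Base using (Bool; true; false; T; _∨_; if_then_else_)
open import Data.Fin.Base using (Fin; zero; suc; toℕ; fromℕ; inject₁)
import Data.Fin.Properties as Finₚ
open import Data.List.Base using (List; []; _∷_; replicate; _++_)
open import Data.Nat.Base as ℕ using (ℕ; zero; suc; _!)
open import Data.Nat.Combinatorics using (_C_; nCn≡1; nC1≡n; k>n⇒nCk≡0; nCk+nC[k+1]≡[n+1]C[k+1])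
open import Data.Nat.Coprimality using (prime⇒coprime; coprime-Bézout)
open import Data.Nat.Divisibility as ℕ∣ using (divides)
open import Data.Nat.DivMod using (_%_; _/_; m%n<n; m≡m%n+[m/n]*n; m*n/n≡m)
open import Data.Nat.GCD using (gcd; module Bézout)
open import Data.Nat.Primality using (Prime; euclidsLemma; prime⇒irreducible; ¬prime[0]; ¬prime[1])
import Data.Nat.Properties as ℕₚ
open import Data.Nat.Solver using (module +-*-Solver)
open import Data.Product.Base using (∃; _,_; _×_; proj₁; proj₂)
open import Data.Sum.Base using (_⊎_; inj₁; inj₂)
open import Function.Base using (_∘_)
open import Level using (_⊔_)
open import Relation.Binary.Definitions using (tri<; tri≈; tri>)
open import Relation.Binary.PropositionalEquality as ≡ using (_≡_; _≢_)
open import Relation.Nullary using (contradiction; ¬_; Dec; yes; no)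
open import Relation.Nullary.Decidable using (map′)

-- Bell polynomials as moments of a linear functional

module BellMoments where
  open import Data.Nat.Base using (_+_; _*_; _^_; _≤_; _<_; s≤s)
  open import Data.Nat.Properties
  open import Data.Nat.Solver using (module +-*-Solver)
  open +-*-Solver
  open ≡ using (refl; cong; cong₂; sym; trans; module ≡-Reasoning)
  open ≡-Reasoning

  sumTo-cong : ∀ n {f g} → (∀ k → f k ≡ g k) → sumTo n f ≡ sumTo n g
  sumTo-cong zero    e = e 0
  sumTo-cong (suc n) e = cong₂ _+_ (sumTo-cong n e) (e (suc n))

  sumTo-+ : ∀ n f g → sumTo n (λ k → f k + g k) ≡ sumTo n f + sumTo n g
  sumTo-+ zero    f g = refl
  sumTo-+ (suc n) f g = trans (cong (_+ (f (suc n) + g (suc n))) (sumTo-+ n f g))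
    (solve 4 (λ a b c d → a :+ b :+ (c :+ d) := a :+ c :+ (b :+ d)) refl (sumTo n f) _ _ _)

  sumTo-shift : ∀ n f → sumTo (suc n) f ≡ f 0 + sumTo n (λ k → f (suc k))
  sumTo-shift zero    f = refl
  sumTo-shift (suc n) f = trans (cong (_+ f (suc (suc n))) (sumTo-shift n f)) (+-assoc (f 0) _ _)

  stirling2-> : ∀ n k → n < k → stirling2 n k ≡ 0
  stirling2-> zero    (suc k) _ = refl
  stirling2-> (suc n) (suc k) (s≤s n<k)
    rewrite stirling2-> n (suc k) (m<n⇒m<1+n n<k) | stirling2-> n k n<k
    = trans (+-identityʳ (suc k * 0)) (*-zeroʳ (suc k))

  -- The value of the umbral functional x^m ↦ b_m(x) at (X + k)^n.
  shiftedBell : ℕ → ℕ → ℕ → ℕ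
  shiftedBell x zero    k = 1
  shiftedBell x (suc n) k = x * shiftedBell x n (suc k) + k * shiftedBell x n k

  -- Both sides are the value at X^{m+n+1}, with X^m expanded in falling factorials.
  stirling-step : ∀ x m n →
    sumTo m (λ k → stirling2 m k * x ^ k * shiftedBell x (suc n) k) ≡
    sumTo (suc m) (λ k → stirling2 (suc m) k * x ^ k * shiftedBell x n k)
  stirling-step x m n = begin
    sumTo m (λ k → S m k * x ^ k * (x * B (suc k) + k * B k))
      ≡⟨ sumTo-cong m (λ k → solve 6 (λ s y x b k b′ →
           s :* y :* (x :* b :+ k :* b′) := s :* (x :* y) :* b :+ k :* s :* y :* b′)
           refl (S m k) (x ^ k) x (B (suc k)) k (B k)) ⟩
    sumTo m (λ k → g k + h k)
      ≡⟨ sumTo-+ m g h ⟩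
    sumTo m g + sumTo m h
      ≡⟨ cong (sumTo m g +_) h-shift ⟩
    sumTo m g + sumTo m (λ k → h (suc k))
      ≡⟨ sumTo-+ m g (λ k → h (suc k)) ⟨
    sumTo m (λ k → g k + h (suc k))
      ≡⟨ sumTo-cong m (λ k → solve 5 (λ s y b k s′ →
           s :* y :* b :+ (con 1 :+ k) :* s′ :* y :* b := ((con 1 :+ k) :* s′ :+ s) :* y :* b)
           refl (S m k) (x ^ suc k) (B (suc k)) k (S m (suc k))) ⟩
    sumTo m (λ k → S (suc m) (suc k) * x ^ suc k * B (suc k))
      ≡⟨ sumTo-shift m (λ k → S (suc m) k * x ^ k * B k) ⟨
    sumTo (suc m) (λ k → S (suc m) k * x ^ k * B k) ∎
    where
    S : ℕ → ℕ → ℕ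
    S = stirling2
    B g h : ℕ → ℕ
    B = shiftedBell x n
    g k = S m k * x ^ suc k * B (suc k)
    h k = k * S m k * x ^ k * B k

    h-last : h (suc m) ≡ 0
    h-last rewrite stirling2-> m (suc m) (n<1+n m) | *-zeroʳ m = refl

    -- The index can be raised by one because both end terms vanish: `h 0` carries the factor 0, and
    -- S(m, m + 1) = 0.
    h-shift : sumTo m h ≡ sumTo m (λ k → h (suc k))
    h-shift = begin
      sumTo m h                             ≡⟨ +-identityʳ _ ⟨
      sumTo m h + 0                         ≡⟨ cong (sumTo m h +_) h-last ⟨
      sumTo (suc m) h                       ≡⟨ sumTo-shift m h ⟩
      sumTo m (λ k → h (suc k))             ∎

  -- X^m is the sum of the S(m, k) (X)_k, and the functional sends (X)_k g(X) to x^k times its value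
  -- at g(X + k); so the sum is the value at X^(m + n). Each induction step moves one factor X into
  -- X^m, until the sum is the Bell polynomial by definition.
  stirling-shiftedBell : ∀ x m n →
    sumTo m (λ k → stirling2 m k * x ^ k * shiftedBell x n k) ≡ bell (n + m) x
  stirling-shiftedBell x m zero    = sumTo-cong m (λ k → *-identityʳ _)
  stirling-shiftedBell x m (suc n) = begin
    _                        ≡⟨ stirling-step x m n ⟩
    _                        ≡⟨ stirling-shiftedBell x (suc m) n ⟩
    bell (n + suc m) x       ≡⟨ cong (λ i → bell i x) (+-suc n m) ⟩
    bell (suc n + m) x       ∎

  shiftedBell-0 : ∀ x n → shiftedBell x n 0 ≡ bell n x
  shiftedBell-0 x n = begin
    shiftedBell x n 0               ≡⟨ +-identityʳ _ ⟨
    1 * 1 * shiftedBell x n 0       ≡⟨ stirling-shiftedBell x 0 n ⟩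
    bell (n + 0) x                  ≡⟨ cong (λ i → bell i x) (+-identityʳ n) ⟩
    bell n x                        ∎

open BellMoments using (shiftedBell; shiftedBell-0)

-- Products, the Bell functional and Lagrange's theorem in a commutative ring

hyperfactorial : ℕ → ℕ
hyperfactorial zero    = 1
hyperfactorial (suc n) = hyperfactorial n ℕ.* suc n ℕ.^ suc n

module RingLemmas {a ℓ} (R : CommutativeRing a ℓ) where
  open CommutativeRing R hiding (zero) public
  open import Algebra.Properties.Semiring.Mult semiring public
    using () renaming (_×_ to _⊠_; ×-homo-+ to ⊠-homo-+; ×1-homo-* to ⊠1-homo-*)
  open import Algebra.Properties.CommutativeSemiring.Exp commutativeSemiring public
    using (_^_; ^-congˡ; ^-congʳ; ^-homo-*; ^-assocʳ; ^-distrib-*)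
  open import Algebra.Properties.Ring ring public using (+-cancelʳ; -‿distribˡ-*; -‿involutive; -0#≈0#; -‿+-comm)
  open import Algebra.Solver.Ring.NaturalCoefficients.Default commutativeSemiring public
    using (solve; con; _:+_; _:*_; _:=_)
  open import Relation.Binary.Reasoning.Setoid setoid public

  nat : ℕ → Carrier
  nat n = n ⊠ 1#

  HasCharacteristic : ℕ → Set ℓ
  HasCharacteristic n = nat n ≈ 0#

  DecidableZero : Set (a ⊔ ℓ)
  DecidableZero = ∀ x → Dec (x ≈ 0#)

  NoZeroDivisors : Set (a ⊔ ℓ)
  NoZeroDivisors = ∀ x y → x * y ≈ 0# → x ≈ 0# ⊎ y ≈ 0#

  Nontrivial : Set ℓ
  Nontrivial = ¬ (1# ≈ 0#)

  nat-cong : ∀ {m n} → m ≡ n → nat m ≈ nat n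
  nat-cong ≡.refl = refl

  nat-+ : ∀ m n → nat (m ℕ.+ n) ≈ nat m + nat n
  nat-+ = ⊠-homo-+ 1#

  nat-* : ∀ m n → nat (m ℕ.* n) ≈ nat m * nat n
  nat-* = ⊠1-homo-*

  nat-1 : nat 1 ≈ 1#
  nat-1 = +-identityʳ 1#

  nat-^ : ∀ m n → nat (m ℕ.^ n) ≈ nat m ^ n
  nat-^ m zero = nat-1
  nat-^ m (suc n) = trans (nat-* m (m ℕ.^ n)) (*-congˡ (nat-^ m n))

  1^ : ∀ n → 1# ^ n ≈ 1#
  1^ zero = refl
  1^ (suc n) = trans (*-identityˡ _) (1^ n)

  x≈y+[x-y] : ∀ x y → x ≈ y + (x - y)
  x≈y+[x-y] x y = sym (begin
    y + (x - y)     ≈⟨ +-comm y (x - y) ⟩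
    x - y + y       ≈⟨ +-assoc x (- y) y ⟩
    x + (- y + y)   ≈⟨ +-congˡ (-‿inverseˡ y) ⟩
    x + 0#          ≈⟨ +-identityʳ x ⟩
    x               ∎)

  *+1-cong : ∀ {x x′ y y′} → x ≈ x′ → y ≈ y′ → x′ * y′ + 1# ≈ 0# → x * y + 1# ≈ 0#
  *+1-cong e e′ h = trans (+-congʳ (*-cong e e′)) h

  -- ∑ runs over 0 ≤ i < n, whereas ∏ runs over 1 ≤ j ≤ n.
  ∑ : ℕ → (ℕ → Carrier) → Carrier
  ∑ zero    f = 0#
  ∑ (suc n) f = ∑ n f + f n

  ∏ : ℕ → (ℕ → Carrier) → Carrier
  ∏ zero    f = 1#
  ∏ (suc n) f = ∏ n f * f (suc n)

  ∑-cong : ∀ n {f g : ℕ → Carrier} → (∀ i → f i ≈ g i) → ∑ n f ≈ ∑ n g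
  ∑-cong zero    e = refl
  ∑-cong (suc n) e = +-cong (∑-cong n e) (e n)

  ∑-+ : ∀ n f g → ∑ n (λ i → f i + g i) ≈ ∑ n f + ∑ n g
  ∑-+ zero    f g = sym (+-identityˡ 0#)
  ∑-+ (suc n) f g = trans (+-congʳ (∑-+ n f g))
    (solve 4 (λ a b c d → a :+ b :+ (c :+ d) := a :+ c :+ (b :+ d)) refl _ _ _ _)

  ∑-*ˡ : ∀ n x f → ∑ n (λ i → x * f i) ≈ x * ∑ n f
  ∑-*ˡ zero    x f = sym (zeroʳ x)
  ∑-*ˡ (suc n) x f = trans (+-congʳ (∑-*ˡ n x f)) (sym (distribˡ x _ _))

  ∑-shift : ∀ n f → f 0 + ∑ n (λ i → f (suc i)) ≈ ∑ n f + f n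
  ∑-shift zero    f = +-comm _ _
  ∑-shift (suc n) f = trans (sym (+-assoc _ _ _)) (+-congʳ (∑-shift n f))

  ∑-zero : ∀ n {f} → (∀ i → i ℕ.< n → f i ≈ 0#) → ∑ n f ≈ 0#
  ∑-zero zero    e = refl
  ∑-zero (suc n) e = trans
    (+-cong (∑-zero n (λ i i<n → e i (ℕₚ.m<n⇒m<1+n i<n))) (e n (ℕₚ.n<1+n n))) (+-identityˡ 0#)

  ∏-cong : ∀ n {f g : ℕ → Carrier} → (∀ i → 1 ℕ.≤ i → i ℕ.≤ n → f i ≈ g i) → ∏ n f ≈ ∏ n g
  ∏-cong zero    e = refl
  ∏-cong (suc n) e = *-cong (∏-cong n (λ i 1≤i i≤n → e i 1≤i (ℕₚ.m≤n⇒m≤1+n i≤n)))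
                            (e (suc n) (ℕ.s≤s ℕ.z≤n) ℕₚ.≤-refl)

  ∏-* : ∀ n f g → ∏ n (λ i → f i * g i) ≈ ∏ n f * ∏ n g
  ∏-* zero    f g = sym (*-identityˡ 1#)
  ∏-* (suc n) f g = trans (*-congʳ (∏-* n f g))
    (solve 4 (λ a b c d → a :* b :* (c :* d) := a :* c :* (b :* d)) refl _ _ _ _)

  ∏-const : ∀ n x → ∏ n (λ _ → x) ≈ x ^ n
  ∏-const zero    x = refl
  ∏-const (suc n) x = trans (*-congʳ (∏-const n x)) (*-comm _ x)

  ∏-zero : ∀ n f j → 1 ℕ.≤ j → j ℕ.≤ n → f j ≈ 0# → ∏ n f ≈ 0#
  ∏-zero zero    f zero    () _ _
  ∏-zero zero    f (suc j) _ () _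
  ∏-zero (suc n) f j 1≤j j≤n e with ℕₚ.m≤n⇒m<n∨m≡n j≤n
  ... | inj₁ j<n = trans (*-congʳ (∏-zero n f j 1≤j (ℕₚ.≤-pred j<n) e)) (zeroˡ _)
  ... | inj₂ ≡.refl = trans (*-congˡ e) (zeroʳ _)

  ∏-shift : ∀ n f → f 1 * ∏ n (λ i → f (suc i)) ≈ ∏ (suc n) f
  ∏-shift zero    f = *-comm _ _
  ∏-shift (suc n) f = trans (sym (*-assoc _ _ _)) (*-congʳ (∏-shift n f))

  ∏-++ : ∀ m n f → ∏ (m ℕ.+ n) f ≈ ∏ m f * ∏ n (λ i → f (m ℕ.+ i))
  ∏-++ m zero f rewrite ℕₚ.+-identityʳ m = sym (*-identityʳ _)
  ∏-++ m (suc n) f rewrite ℕₚ.+-suc m n = trans (*-congʳ (∏-++ m n f)) (*-assoc _ _ _)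

  ∏-reverse : ∀ n f g → (∀ i j → suc (i ℕ.+ j) ≡ n → f (suc i) ≈ g (suc j)) → ∏ n f ≈ ∏ n g
  ∏-reverse zero    f g e = refl
  ∏-reverse (suc n) f g e = begin
    ∏ n f * f (suc n)               ≈⟨ *-cong (∏-reverse n f (λ j → g (suc j)) e′)
                                              (e n 0 (≡.cong suc (ℕₚ.+-identityʳ n))) ⟩
    ∏ n (λ j → g (suc j)) * g 1     ≈⟨ *-comm _ _ ⟩
    g 1 * ∏ n (λ j → g (suc j))     ≈⟨ ∏-shift n g ⟩
    ∏ (suc n) g                     ∎
    where
    e′ : ∀ i j → suc (i ℕ.+ j) ≡ n → f (suc i) ≈ g (suc (suc j))
    e′ i j i+j = e i (suc j) (≡.cong suc (≡.trans (ℕₚ.+-suc i j) i+j))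

  ∏-pairs : ∀ n f → ∏ (n ℕ.+ n) f ≈ ∏ n (λ i → f (i ℕ.+ i ℕ.∸ 1) * f (i ℕ.+ i))
  ∏-pairs zero    f = refl
  ∏-pairs (suc n) f rewrite ℕₚ.+-suc n n = trans (*-assoc _ _ _) (*-congʳ (∏-pairs n f))

  ∏-nat : ∀ n → ∏ n nat ≈ nat (n !)
  ∏-nat zero    = sym nat-1
  ∏-nat (suc n) = trans (*-congʳ (∏-nat n)) (trans (*-comm _ _) (sym (nat-* (suc n) (n !))))

  rise : ℕ → Carrier → Carrier
  rise n y = ∏ n (λ j → y + nat j)

  -- superRise n y = ∏_{0<j<n} (y + j)^{n-j}.
  superRise : ℕ → Carrier → Carrier
  superRise zero    y = 1#
  superRise (suc n) y = superRise n y * rise n y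

  hyperRise : ℕ → Carrier → Carrier
  hyperRise n y = ∏ n (λ j → (y + nat j) ^ j)

  rise-cong : ∀ n {x y} → x ≈ y → rise n x ≈ rise n y
  rise-cong n e = ∏-cong n (λ _ _ _ → +-congʳ e)

  superRise-cong : ∀ n {x y} → x ≈ y → superRise n x ≈ superRise n y
  superRise-cong zero    e = refl
  superRise-cong (suc n) e = *-cong (superRise-cong n e) (rise-cong n e)

  +-nat-suc : ∀ y j → y + nat (suc j) ≈ y + 1# + nat j
  +-nat-suc y j = sym (+-assoc y 1# (nat j))

  rise-shift : ∀ n y → rise (suc n) y ≈ (y + 1#) * rise n (y + 1#)
  rise-shift n y = begin
    rise (suc n) y                             ≈⟨ ∏-shift n _ ⟨
    (y + nat 1) * ∏ n (λ j → y + nat (suc j))  ≈⟨ *-cong (+-congˡ nat-1) (∏-cong n (λ j _ _ → +-nat-suc y j)) ⟩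
    (y + 1#) * rise n (y + 1#)                 ∎

  -- Each of the n nonempty rising factorials in the product starts with `y + 1#`. Taking these
  -- factors out leaves the rising factorials of `y + 1#`, each shorter by one.
  superRise-shift : ∀ n y → superRise (suc n) y ≈ (y + 1#) ^ n * superRise n (y + 1#)
  superRise-shift zero    y = refl
  superRise-shift (suc n) y = begin
    superRise (suc n) y * rise (suc n) y
      ≈⟨ *-cong (superRise-shift n y) (rise-shift n y) ⟩
    (y + 1#) ^ n * superRise n (y + 1#) * ((y + 1#) * rise n (y + 1#))
      ≈⟨ solve 4 (λ u v w x → u :* v :* (w :* x) := w :* u :* (v :* x)) refl _ _ _ _ ⟩
    (y + 1#) ^ suc n * superRise (suc n) (y + 1#) ∎

  -- The factor `y + nat j` has exponent n + 1 - j in one product and j in the other. For n + 1 = p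
  -- the result is a p-th power, so Frobenius can take it out of a sum.
  superRise*hyperRise : ∀ n y → superRise (suc n) y * hyperRise n y ≈ rise n y ^ suc n
  superRise*hyperRise zero    y = *-identityʳ _
  superRise*hyperRise (suc n) y = begin
    s * rise (suc n) y * (h * z ^ suc n)
      ≈⟨ solve 4 (λ u v w x → u :* v :* (w :* x) := u :* w :* x :* v) refl _ _ _ _ ⟩
    s * h * z ^ suc n * rise (suc n) y
      ≈⟨ *-congʳ (*-congʳ (superRise*hyperRise n y)) ⟩
    rise n y ^ suc n * z ^ suc n * rise (suc n) y
      ≈⟨ *-congʳ (^-distrib-* (rise n y) z (suc n)) ⟨
    rise (suc n) y ^ suc n * rise (suc n) y
      ≈⟨ *-comm _ _ ⟩
    rise (suc n) y ^ suc (suc n) ∎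
    where
    s h z : Carrier
    s = superRise (suc n) y
    h = hyperRise n y
    z = y + nat (suc n)

  ∏ₗ : Carrier → List Carrier → Carrier
  ∏ₗ x []       = 1#
  ∏ₗ x (t ∷ ts) = (x + t) * ∏ₗ x ts

  ∏ₗ-cong : ∀ {x y} ts → x ≈ y → ∏ₗ x ts ≈ ∏ₗ y ts
  ∏ₗ-cong []       e = refl
  ∏ₗ-cong (t ∷ ts) e = *-cong (+-congʳ e) (∏ₗ-cong ts e)

  ∏ₗ-++ : ∀ x ts us → ∏ₗ x (ts ++ us) ≈ ∏ₗ x ts * ∏ₗ x us
  ∏ₗ-++ x []       us = sym (*-identityˡ _)
  ∏ₗ-++ x (t ∷ ts) us = trans (*-congˡ (∏ₗ-++ x ts us)) (sym (*-assoc _ _ _))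

  ∏ₗ-replicate : ∀ x n t → ∏ₗ x (replicate n t) ≈ (x + t) ^ n
  ∏ₗ-replicate x zero    t = refl
  ∏ₗ-replicate x (suc n) t = *-congˡ (∏ₗ-replicate x n t)

  -- bellFunctional c s ts is the value at ∏_{t ∈ ts} (x + s + t) of the linear functional
  -- x^n ↦ b_n(c); the recursion is its characteristic property x f(x) ↦ c · (value at f(x + 1)).
  bellFunctional : Carrier → Carrier → List Carrier → Carrier
  bellFunctional c s []       = 1#
  bellFunctional c s (t ∷ ts) = c * bellFunctional c (1# + s) ts + (s + t) * bellFunctional c s ts

  -- For c = 0 the functional kills every multiple of x, so only the value at x = 0 survives.
  bellFunctional-zero : ∀ {c} s ts → c ≈ 0# → bellFunctional c s ts ≈ ∏ₗ s ts
  bellFunctional-zero s []       e = refl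
  bellFunctional-zero s (t ∷ ts) e =
    trans (+-cong (trans (*-congʳ e) (zeroˡ _)) (*-congˡ (bellFunctional-zero s ts e))) (+-identityˡ _)

  bellFunctional-shiftedBell : ∀ {c x s} n k → c ≈ nat x → s ≈ nat k →
    bellFunctional c s (replicate n 0#) ≈ nat (shiftedBell x n k)
  bellFunctional-shiftedBell zero    k c≈x s≈k = sym nat-1
  bellFunctional-shiftedBell {c} {x} {s} (suc n) k c≈x s≈k = begin
    c * bellFunctional c (1# + s) ts + (s + 0#) * bellFunctional c s ts
      ≈⟨ +-cong (*-cong c≈x (bellFunctional-shiftedBell n (suc k) c≈x (+-congˡ s≈k)))
                (*-cong (trans (+-identityʳ s) s≈k) (bellFunctional-shiftedBell n k c≈x s≈k)) ⟩
    nat x * nat (shiftedBell x n (suc k)) + nat k * nat (shiftedBell x n k)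
      ≈⟨ +-cong (nat-* x _) (nat-* k _) ⟨
    nat (x ℕ.* shiftedBell x n (suc k)) + nat (k ℕ.* shiftedBell x n k)
      ≈⟨ nat-+ (x ℕ.* shiftedBell x n (suc k)) _ ⟨
    nat (shiftedBell x (suc n) k) ∎
    where
    ts : List Carrier
    ts = replicate n 0#

  bellFunctional-bell : ∀ {c x} n → c ≈ nat x →
    bellFunctional c 0# (replicate n 0#) ≈ nat (bell n x)
  bellFunctional-bell {x = x} n c≈x =
    trans (bellFunctional-shiftedBell n 0 c≈x refl) (nat-cong (shiftedBell-0 x n))

  staircase : ℕ → Carrier → List Carrier
  staircase zero    s = []
  staircase (suc n) s = replicate (suc n) (nat (suc n) + s) ++ staircase n s

  ∏ₗ-staircase : ∀ n x s → ∏ₗ x (staircase n s) ≈ ∏ n (λ j → (x + (nat j + s)) ^ j)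
  ∏ₗ-staircase zero    x s = refl
  ∏ₗ-staircase (suc n) x s = begin
    ∏ₗ x (replicate (suc n) (nat (suc n) + s) ++ staircase n s)
      ≈⟨ ∏ₗ-++ x (replicate (suc n) (nat (suc n) + s)) (staircase n s) ⟩
    ∏ₗ x (replicate (suc n) (nat (suc n) + s)) * ∏ₗ x (staircase n s)
      ≈⟨ *-cong (∏ₗ-replicate x (suc n) _) (∏ₗ-staircase n x s) ⟩
    (x + (nat (suc n) + s)) ^ suc n * ∏ n (λ j → (x + (nat j + s)) ^ j)
      ≈⟨ *-comm _ _ ⟩
    ∏ (suc n) (λ j → (x + (nat j + s)) ^ j) ∎

  ∏-hyperfactorial : ∀ n → ∏ n (λ j → nat j ^ j) ≈ nat (hyperfactorial n)
  ∏-hyperfactorial zero    = sym nat-1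
  ∏-hyperfactorial (suc n) = trans
    (*-cong (∏-hyperfactorial n) (sym (nat-^ (suc n) (suc n))))
    (sym (nat-* (hyperfactorial n) _))

  hyperRise-0 : ∀ n → hyperRise n 0# ≈ nat (hyperfactorial n)
  hyperRise-0 n = trans (∏-cong n (λ j _ _ → ^-congˡ j (+-identityˡ _))) (∏-hyperfactorial n)

  -- `sumTo` starts at 0 and `∏` at 1; the condition on `f 0` bridges the difference.
  ^-sumTo : ∀ x f → f 0 ≡ 0 → ∀ n → x ^ sumTo n f ≈ ∏ n (λ j → x ^ f j)
  ^-sumTo x f f0 zero    = ^-congʳ x f0
  ^-sumTo x f f0 (suc n) = trans (^-homo-* x (sumTo n f) (f (suc n))) (*-congʳ (^-sumTo x f f0 n))

  -- A Horner scheme for functions instead of formal polynomials: root counting below only compares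
  -- values, and it takes place in several rings.
  data Deg< : ℕ → (Carrier → Carrier) → Set (a ⊔ ℓ) where
    nil  : ∀ {f} → (∀ x → f x ≈ 0#) → Deg< 0 f
    snoc : ∀ {n f g} b → Deg< n g → (∀ x → f x ≈ b + x * g x) → Deg< (suc n) f

  Deg<-resp : ∀ {n f g} → (∀ x → g x ≈ f x) → Deg< n f → Deg< n g
  Deg<-resp e (nil z)      = nil (λ x → trans (e x) (z x))
  Deg<-resp e (snoc b d h) = snoc b d (λ x → trans (e x) (h x))

  Deg<-zero : ∀ n {f} → (∀ x → f x ≈ 0#) → Deg< n f
  Deg<-zero zero    z = nil z
  Deg<-zero (suc n) z = snoc 0# (Deg<-zero n (λ x → refl))
    (λ x → trans (z x) (sym (trans (+-identityˡ _) (zeroʳ x))))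

  Deg<-const : ∀ n b → Deg< (suc n) (λ _ → b)
  Deg<-const n b = snoc b (Deg<-zero n (λ x → refl))
    (λ x → sym (trans (+-congˡ (zeroʳ x)) (+-identityʳ b)))

  Deg<-suc : ∀ {n f} → Deg< n f → Deg< (suc n) f
  Deg<-suc (nil z)      = Deg<-zero 1 z
  Deg<-suc (snoc b d h) = snoc b (Deg<-suc d) h

  Deg<-+ : ∀ {n f g} → Deg< n f → Deg< n g → Deg< n (λ x → f x + g x)
  Deg<-+ (nil y)      (nil z)        = nil (λ x → trans (+-cong (y x) (z x)) (+-identityʳ 0#))
  Deg<-+ (snoc b d h) (snoc b′ d′ h′) = snoc (b + b′) (Deg<-+ d d′) (λ x → trans (+-cong (h x) (h′ x))
    (solve 5 (λ b x u b′ v → b :+ x :* u :+ (b′ :+ x :* v) := b :+ b′ :+ x :* (u :+ v)) refl b x _ b′ _))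

  Deg<-* : ∀ {n f} b → Deg< n f → Deg< n (λ x → b * f x)
  Deg<-* b (nil z)      = nil (λ x → trans (*-congˡ (z x)) (zeroʳ b))
  Deg<-* b (snoc b′ d h) = snoc (b * b′) (Deg<-* b d) (λ x → trans (*-congˡ (h x))
    (solve 4 (λ b b′ x u → b :* (b′ :+ x :* u) := b :* b′ :+ x :* (b :* u)) refl b b′ x _))

  Deg<-x* : ∀ {n f} → Deg< n f → Deg< (suc n) (λ x → x * f x)
  Deg<-x* d = snoc 0# d (λ x → sym (+-identityˡ _))

  Deg<-[x+b]* : ∀ {n f} b → Deg< n f → Deg< (suc n) (λ x → (x + b) * f x)
  Deg<-[x+b]* b d = Deg<-resp (λ x → distribʳ _ x b) (Deg<-+ (Deg<-x* d) (Deg<-suc (Deg<-* b d)))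

  Deg<-^ : ∀ n → Deg< (suc n) (λ x → x ^ n)
  Deg<-^ zero    = Deg<-const 0 1#
  Deg<-^ (suc n) = Deg<-x* (Deg<-^ n)

  Deg<-∏ : ∀ n (b : ℕ → Carrier) → Deg< (suc n) (λ x → ∏ n (λ j → x + b j))
  Deg<-∏ zero    b = Deg<-const 0 1#
  Deg<-∏ (suc n) b = Deg<-resp (λ x → *-comm _ _) (Deg<-[x+b]* (b (suc n)) (Deg<-∏ n b))

  Deg<-∑ : ∀ n m {f : ℕ → Carrier → Carrier} → (∀ i → Deg< n (f i)) → Deg< n (λ x → ∑ m (λ i → f i x))
  Deg<-∑ n zero    d = Deg<-zero n (λ x → refl)
  Deg<-∑ n (suc m) d = Deg<-+ (Deg<-∑ n m d) (d m)

  rise-monic : ∀ n → ∃ λ g → Deg< n g × (∀ x → rise n x ≈ x ^ n + g x)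
  rise-monic zero    = (λ _ → 0#) , nil (λ x → refl) , (λ x → sym (+-identityʳ 1#))
  rise-monic (suc n) with rise-monic n
  ... | g , d , e = (λ x → b * x ^ n + (x + b) * g x) ,
    Deg<-+ (Deg<-* b (Deg<-^ n)) (Deg<-[x+b]* b d) ,
    (λ x → trans (*-congʳ (e x))
      (solve 4 (λ u v x b → (u :+ v) :* (x :+ b) := x :* u :+ (b :* u :+ (x :+ b) :* v)) refl _ _ x b))
    where
    b : Carrier
    b = nat (suc n)

  -- f(x) - f(r) = (x - r) q(x), written without subtraction.
  factor : ∀ {n f} → Deg< (suc n) f → ∀ r →
    ∃ λ q → Deg< n q × (∀ x → f x + r * q x ≈ f r + x * q x)
  factor {zero} (snoc {f = f} {g} b (nil z) h) r = (λ _ → 0#) , nil (λ x → refl) , λ x → begin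
    f x + r * 0#         ≈⟨ +-cong (h x) (zeroʳ r) ⟩
    b + x * g x + 0#     ≈⟨ +-identityʳ _ ⟩
    b + x * g x          ≈⟨ +-congˡ (*-congˡ (z x)) ⟩
    b + x * 0#           ≈⟨ +-congˡ (trans (zeroʳ x) (sym (zeroʳ r))) ⟩
    b + r * 0#           ≈⟨ +-congˡ (*-congˡ (z r)) ⟨
    b + r * g r          ≈⟨ h r ⟨
    f r                  ≈⟨ +-identityʳ _ ⟨
    f r + 0#             ≈⟨ +-congˡ (zeroʳ x) ⟨
    f r + x * 0#         ∎
  factor {suc n} (snoc {f = f} {g} b d h) r with factor d r
  ... | q , d′ , e = (λ x → g r + x * q x) , snoc (g r) d′ (λ x → refl) , λ x → begin
    f x + r * (g r + x * q x)              ≈⟨ +-congʳ (h x) ⟩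
    b + x * g x + r * (g r + x * q x)
      ≈⟨ solve 6 (λ b x u r v w → b :+ x :* u :+ r :* (v :+ x :* w) := b :+ r :* v :+ x :* (u :+ r :* w))
               refl b x _ r _ _ ⟩
    b + r * g r + x * (g x + r * q x)      ≈⟨ +-cong (sym (h r)) (*-congˡ (e x)) ⟩
    f r + x * (g r + x * q x)              ∎

  -- Lagrange's theorem; the first hypothesis on r says that r i - r j is not a zero divisor.
  Deg<-roots : ∀ n {f} → Deg< n f → (r : ℕ → Carrier) →
    (∀ {i j} → i ℕ.< j → j ℕ.< n → ∀ z → r i * z ≈ r j * z → z ≈ 0#) →
    (∀ {i} → i ℕ.< n → f (r i) ≈ 0#) → ∀ x → f x ≈ 0#
  Deg<-roots zero    (nil z) r _ _ = z
  Deg<-roots (suc n) {f} d r distinct root with factor d (r n)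
  ... | q , d′ , e = λ x → begin
    f x                ≈⟨ +-identityʳ _ ⟨
    f x + 0#           ≈⟨ +-congˡ (trans (*-congˡ (q≈0 x)) (zeroʳ _)) ⟨
    f x + r n * q x    ≈⟨ e x ⟩
    f (r n) + x * q x  ≈⟨ +-cong (root (ℕₚ.n<1+n n)) (trans (*-congˡ (q≈0 x)) (zeroʳ _)) ⟩
    0# + 0#            ≈⟨ +-identityʳ 0# ⟩
    0#                 ∎
    where
    q≈0 : ∀ x → q x ≈ 0#
    q≈0 = Deg<-roots n d′ r (λ i<j j<n → distinct i<j (ℕₚ.m<n⇒m<1+n j<n)) λ {i} i<n →
      distinct i<n (ℕₚ.n<1+n n) (q (r i)) (begin
        r i * q (r i)                ≈⟨ +-identityˡ _ ⟨
        0# + r i * q (r i)           ≈⟨ +-congʳ (root (ℕₚ.n<1+n n)) ⟨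
        f (r n) + r i * q (r i)      ≈⟨ e (r i) ⟨
        f (r i) + r n * q (r i)      ≈⟨ +-congʳ (root (ℕₚ.m<n⇒m<1+n i<n)) ⟩
        0# + r n * q (r i)           ≈⟨ +-identityˡ _ ⟩
        r n * q (r i)                ∎)

-- Binomial coefficients divisible by a prime

module BinomialDivisibility where
  open import Data.Nat.Base
  open import Data.Nat.Properties
  open import Data.Nat.Solver using (module +-*-Solver)
  open +-*-Solver
  open ≡ using (refl; cong; cong₂; sym; trans; module ≡-Reasoning)
  open ≡-Reasoning

  absorption : ∀ n k → suc k * (suc n C suc k) ≡ suc n * (n C k)
  absorption n zero = trans (*-identityˡ (suc n C 1)) (trans (nC1≡n (suc n)) (sym (*-identityʳ (suc n))))
  absorption zero (suc k) rewrite k>n⇒nCk≡0 {1} {suc (suc k)} (s≤s (s≤s z≤n)) | k>n⇒nCk≡0 {0} {suc k} (s≤s z≤n)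
    = *-zeroʳ (suc (suc k))
  absorption (suc n) (suc k) = begin
    suc (suc k) * (suc (suc n) C suc (suc k))
      ≡⟨ cong (suc (suc k) *_) (nCk+nC[k+1]≡[n+1]C[k+1] (suc n) (suc k)) ⟨
    suc (suc k) * ((suc n C suc k) + (suc n C suc (suc k)))
      ≡⟨ solve 3 (λ k b c → (con 2 :+ k) :* (b :+ c) := b :+ (con 1 :+ k) :* b :+ (con 2 :+ k) :* c) refl k (suc n C suc k) _ ⟩
    (suc n C suc k) + suc k * (suc n C suc k) + suc (suc k) * (suc n C suc (suc k))
      ≡⟨ cong₂ (λ u v → (suc n C suc k) + u + v) (absorption n k) (absorption n (suc k)) ⟩
    (suc n C suc k) + suc n * (n C k) + suc n * (n C suc k)
      ≡⟨ solve 4 (λ n b c d → b :+ (con 1 :+ n) :* c :+ (con 1 :+ n) :* d := b :+ (con 1 :+ n) :* (c :+ d)) refl n (suc n C suc k) (n C k) _ ⟩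
    (suc n C suc k) + suc n * ((n C k) + (n C suc k))
      ≡⟨ cong (λ u → (suc n C suc k) + suc n * u) (nCk+nC[k+1]≡[n+1]C[k+1] n k) ⟩
    suc (suc n) * (suc n C suc k) ∎

  -- By absorption p divides (k + 1) C(p, k + 1), and p cannot divide k + 1 because 0 < k + 1 < p.
  prime∣binomial : ∀ {q k} → Prime (suc q) → k < q → suc q ℕ∣.∣ (suc q C suc k)
  prime∣binomial {q} {k} pp k<q with euclidsLemma (suc k) (suc q C suc k) pp
    (divides (q C k) (trans (absorption q k) (*-comm (suc q) (q C k))))
  ... | inj₁ p∣k = contradiction (ℕ∣.∣⇒≤ p∣k) (<⇒≱ (s≤s k<q))
  ... | inj₂ p∣C = p∣C

open BinomialDivisibility using (prime∣binomial)

-- Frobenius, units and rising factorials in characteristic p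

module CharP {a ℓ} (R : CommutativeRing a ℓ) (q : ℕ) (p-prime : Prime (suc q))
    (char : RingLemmas.HasCharacteristic R (suc q)) where

  open RingLemmas R
  import Algebra.Properties.CommutativeSemiring.Binomial commutativeSemiring as Binomial
  open import Algebra.Properties.Semiring.Sum semiring using (sum; sum-init-last; sum-cong-≋; sum-replicate-zero)
  open import Algebra.Properties.Semiring.Mult semiring using (×-assoc-*; ×-congʳ)

  p : ℕ
  p = suc q

  nat-∣ : ∀ {n} → p ℕ∣.∣ n → nat n ≈ 0#
  nat-∣ (divides k ≡.refl) = trans (nat-* k p) (trans (*-congˡ char) (zeroʳ _))

  ⊠-∣ : ∀ {n} x → p ℕ∣.∣ n → n ⊠ x ≈ 0#
  ⊠-∣ {n} x p∣n = begin
    n ⊠ x          ≈⟨ ×-congʳ n (*-identityˡ x) ⟨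
    n ⊠ (1# * x)   ≈⟨ ×-assoc-* n 1# x ⟨
    nat n * x      ≈⟨ *-congʳ (nat-∣ p∣n) ⟩
    0# * x         ≈⟨ zeroˡ x ⟩
    0#             ∎

  frobenius : ∀ x y → (x + y) ^ p ≈ x ^ p + y ^ p
  frobenius x y = begin
    (x + y) ^ p
      ≈⟨ Binomial.theorem p x y ⟩
    sum t
      ≈⟨ sum-init-last t ⟩
    t zero + sum (λ i → t (suc (inject₁ i))) + t (fromℕ p)
      ≈⟨ +-cong (+-cong t-first (trans (sum-cong-≋ t-mid) (sum-replicate-zero q))) t-last ⟩
    y ^ p + 0# + x ^ p
      ≈⟨ trans (+-congʳ (+-identityʳ _)) (+-comm _ _) ⟩
    x ^ p + y ^ p ∎
    where
    t : Fin (suc p) → Carrier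
    t = Binomial.binomialTerm x y p

    t-first : t zero ≈ y ^ p
    t-first = trans (+-identityʳ _) (*-identityˡ _)

    t-mid : ∀ i → t (suc (inject₁ i)) ≈ 0#
    t-mid i = ⊠-∣ _ (prime∣binomial p-prime
      (≡.subst (ℕ._< q) (≡.sym (Finₚ.toℕ-inject₁ i)) (Finₚ.toℕ<n i)))

    t-last : t (fromℕ p) ≈ x ^ p
    t-last rewrite Finₚ.toℕ-fromℕ q | nCn≡1 p | ℕₚ.n∸n≡0 q = trans (+-identityʳ _) (*-identityʳ _)

  0^p : 0# ^ p ≈ 0#
  0^p = zeroˡ _

  frobenius-∑ : ∀ n f → ∑ n f ^ p ≈ ∑ n (λ i → f i ^ p)
  frobenius-∑ zero    f = 0^p
  frobenius-∑ (suc n) f = trans (frobenius _ _) (+-congʳ (frobenius-∑ n f))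

  -- Fermat's little theorem, as additivity of Frobenius applied to 1 + ... + 1.
  nat-^p : ∀ n → nat n ^ p ≈ nat n
  nat-^p zero    = 0^p
  nat-^p (suc n) = trans (frobenius 1# (nat n)) (+-cong (1^ p) (nat-^p n))

  -- The Bézout identity over ℕ has two sign patterns; they give the inverse as the image of y or as
  -- its negative.
  nat-inverse : ∀ {n} → 1 ℕ.≤ n → n ℕ.< p → ∃ λ u → u * nat n ≈ 1#
  nat-inverse {suc n} _ n<p with coprime-Bézout (prime⇒coprime p-prime n<p)
  ... | Bézout.-+ x y eq = nat y , (begin
    nat y * nat (suc n)             ≈⟨ nat-* y (suc n) ⟨
    nat (y ℕ.* suc n)               ≈⟨ nat-cong eq ⟨
    nat (1 ℕ.+ x ℕ.* p)             ≈⟨ +-congˡ (nat-∣ (ℕ∣.n∣m*n x)) ⟩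
    1# + 0#                         ≈⟨ +-identityʳ 1# ⟩
    1#                              ∎)
  ... | Bézout.+- x y eq = - nat y , (begin
    - nat y * nat (suc n)                   ≈⟨ +-identityˡ _ ⟨
    0# + - nat y * nat (suc n)              ≈⟨ +-congʳ (nat-∣ (ℕ∣.n∣m*n x)) ⟨
    nat (x ℕ.* p) + - nat y * nat (suc n)   ≈⟨ +-cong (nat-cong (≡.sym eq)) (sym (-‿distribˡ-* _ _)) ⟩
    1# + nat (y ℕ.* suc n) + - (nat y * nat (suc n))
                                            ≈⟨ +-assoc _ _ _ ⟩
    1# + (nat (y ℕ.* suc n) + - (nat y * nat (suc n)))
                                            ≈⟨ +-congˡ (trans (+-congʳ (nat-* y (suc n))) (-‿inverseʳ _)) ⟩
    1# + 0#                                 ≈⟨ +-identityʳ 1# ⟩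
    1#                                      ∎)

  nat-cancel : ∀ {n} → 1 ℕ.≤ n → n ℕ.< p → ∀ {x y} → nat n * x ≈ nat n * y → x ≈ y
  nat-cancel {n} 1≤n n<p {x} {y} e with nat-inverse 1≤n n<p
  ... | u , un≈1 = begin
    x                ≈⟨ *-identityˡ x ⟨
    1# * x           ≈⟨ *-congʳ un≈1 ⟨
    u * nat n * x    ≈⟨ *-assoc _ _ _ ⟩
    u * (nat n * x)  ≈⟨ *-congˡ e ⟩
    u * (nat n * y)  ≈⟨ *-assoc _ _ _ ⟨
    u * nat n * y    ≈⟨ *-congʳ un≈1 ⟩
    1# * y           ≈⟨ *-identityˡ y ⟩
    y                ∎

  nat-^q : ∀ {n} → 1 ℕ.≤ n → n ℕ.< p → nat n ^ q ≈ 1#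
  nat-^q {n} 1≤n n<p = nat-cancel 1≤n n<p (trans (nat-^p n) (sym (*-identityʳ _)))

  -- The difference j - i is among 1, ..., p - 1 and hence a unit. This is the separation of nodes
  -- that `Deg<-roots` asks for, available even in rings with zero divisors.
  nat-distinct : ∀ {i j} → i ℕ.< j → j ℕ.< p → ∀ z → nat i * z ≈ nat j * z → z ≈ 0#
  nat-distinct {i} {j} i<j j<p z e =
    nat-cancel {j ℕ.∸ i} (ℕₚ.m<n⇒0<n∸m i<j) (ℕₚ.≤-<-trans (ℕₚ.m∸n≤m j i) j<p)
      (trans (+-cancelʳ (nat i * z) _ _ (begin
        nat (j ℕ.∸ i) * z + nat i * z    ≈⟨ distribʳ z _ _ ⟨
        (nat (j ℕ.∸ i) + nat i) * z      ≈⟨ *-congʳ (nat-+ (j ℕ.∸ i) i) ⟨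
        nat (j ℕ.∸ i ℕ.+ i) * z          ≈⟨ *-congʳ (nat-cong (ℕₚ.m∸n+n≡m (ℕₚ.<⇒≤ i<j))) ⟩
        nat j * z                        ≈⟨ e ⟨
        nat i * z                        ≈⟨ +-identityˡ _ ⟨
        0# + nat i * z                   ∎)) (sym (zeroʳ _)))

  nat-suc-distinct : ∀ {i j} → i ℕ.< j → j ℕ.< q → ∀ z → nat (suc i) * z ≈ nat (suc j) * z → z ≈ 0#
  nat-suc-distinct i<j j<q = nat-distinct (ℕ.s≤s i<j) (ℕ.s≤s j<q)

  rise-q-nat : ∀ k → 1 ℕ.≤ k → k ℕ.< p → rise q (nat k) ≈ 0#
  rise-q-nat k 1≤k k<p = ∏-zero q _ (p ℕ.∸ k) (ℕₚ.m<n⇒0<n∸m k<p)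
    (ℕₚ.∸-monoʳ-≤ p 1≤k)
    (begin
      nat k + nat (p ℕ.∸ k)   ≈⟨ nat-+ k (p ℕ.∸ k) ⟨
      nat (k ℕ.+ (p ℕ.∸ k))   ≈⟨ nat-cong (ℕₚ.m+[n∸m]≡n (ℕₚ.<⇒≤ k<p)) ⟩
      nat p                   ≈⟨ char ⟩
      0#                      ∎)

  1≤q : 1 ℕ.≤ q
  1≤q = lemma p-prime
    where
    lemma : ∀ {q} → Prime (suc q) → 1 ℕ.≤ q
    lemma {zero}  pp = contradiction pp ¬prime[1]
    lemma {suc q} pp = ℕ.s≤s ℕ.z≤n

  -- Both `rise q x` and x^q - 1 are monic of degree q and vanish at 1, ..., q, so their difference
  -- has degree less than q and q roots. At x = 0 this is Wilson's theorem.
  rise-q : ∀ x → rise q x + 1# ≈ x ^ q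
  rise-q x with rise-monic q
  ... | g , d , e = begin
    rise q x + 1#        ≈⟨ +-congʳ (e x) ⟩
    x ^ q + g x + 1#     ≈⟨ +-assoc _ _ _ ⟩
    x ^ q + (g x + 1#)   ≈⟨ +-congˡ (Deg<-roots q (d+1 1≤q d) (λ i → nat (suc i)) nat-suc-distinct root x) ⟩
    x ^ q + 0#           ≈⟨ +-identityʳ _ ⟩
    x ^ q                ∎
    where
    d+1 : ∀ {n} → 1 ℕ.≤ n → Deg< n g → Deg< n (λ x → g x + 1#)
    d+1 (ℕ.s≤s _) d = Deg<-+ d (Deg<-const _ 1#)

    root : ∀ {i} → i ℕ.< q → g (nat (suc i)) + 1# ≈ 0#
    root {i} i<q = begin
      g k + 1#          ≈⟨ +-comm _ _ ⟩
      1# + g k          ≈⟨ +-congʳ (nat-^q {suc i} (ℕ.s≤s ℕ.z≤n) (ℕ.s≤s i<q)) ⟨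
      k ^ q + g k       ≈⟨ e k ⟨
      rise q k          ≈⟨ rise-q-nat (suc i) (ℕ.s≤s ℕ.z≤n) (ℕ.s≤s i<q) ⟩
      0#                ∎
      where
      k : Carrier
      k = nat (suc i)

  +p-periodic : ∀ x → x + nat p ≈ x
  +p-periodic x = trans (+-congˡ char) (+-identityʳ x)

  rise-p : ∀ x → rise p x + x ≈ x ^ p
  rise-p x = begin
    rise q x * (x + nat p) + x   ≈⟨ +-congʳ (*-congˡ (+p-periodic x)) ⟩
    rise q x * x + x             ≈⟨ solve 2 (λ r x → r :* x :+ x := x :* (r :+ con 1)) refl (rise q x) x ⟩
    x * (rise q x + 1#)          ≈⟨ *-congˡ (rise-q x) ⟩
    x ^ p                        ∎

  -- Orbit sums and the trace formula

  orbitSum : (Carrier → Carrier) → Carrier → Carrier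
  orbitSum f y = ∑ p (λ i → f (y + nat i))

  Congruent : (Carrier → Carrier) → Set _
  Congruent f = ∀ {x y} → x ≈ y → f x ≈ f y

  -- Since y + p = y, the points y, ..., y + (p - 1) form a cycle under translation by 1.
  orbitSum-shift : ∀ f → Congruent f → ∀ y → orbitSum (λ x → f (x + 1#)) y ≈ orbitSum f y
  orbitSum-shift f f-cong y = +-cancelʳ (f y) _ _ (begin
    ∑ p (λ i → f (y + nat i + 1#)) + f y
      ≈⟨ +-comm _ _ ⟩
    f y + ∑ p (λ i → f (y + nat i + 1#))
      ≈⟨ +-cong (f-cong (sym (+-identityʳ y))) (∑-cong p (λ i → f-cong
           (trans (+-assoc _ _ _) (+-congˡ (+-comm _ _))))) ⟩
    f (y + nat 0) + ∑ p (λ i → f (y + nat (suc i)))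
      ≈⟨ ∑-shift p (λ i → f (y + nat i)) ⟩
    orbitSum f y + f (y + nat p)
      ≈⟨ +-congˡ (f-cong (+p-periodic y)) ⟩
    orbitSum f y + f y ∎)

  orbitSum-periodic : ∀ f → Congruent f → ∀ n y → orbitSum f (y + nat n) ≈ orbitSum f y
  orbitSum-periodic f f-cong zero y = ∑-cong p (λ i → f-cong (+-congʳ (+-identityʳ y)))
  orbitSum-periodic f f-cong (suc n) y = begin
    orbitSum f (y + nat (suc n))
      ≈⟨ ∑-cong p (λ i → f-cong (solve 3 (λ y m i → y :+ (con 1 :+ m) :+ i := y :+ m :+ i :+ con 1) refl y (nat n) (nat i))) ⟩
    orbitSum (λ x → f (x + 1#)) (y + nat n)
      ≈⟨ orbitSum-shift f f-cong (y + nat n) ⟩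
    orbitSum f (y + nat n)
      ≈⟨ orbitSum-periodic f f-cong n y ⟩
    orbitSum f y ∎

  orbitSum-rise-0 : orbitSum (rise q) 0# + 1# ≈ 0#
  orbitSum-rise-0 = begin
    ∑ p (λ i → rise q (0# + nat i)) + 1#
      ≈⟨ +-congʳ (∑-head q _ (λ i i<q → trans (rise-cong q (+-identityˡ _))
           (rise-q-nat (suc i) (ℕ.s≤s ℕ.z≤n) (ℕ.s≤s i<q)))) ⟩
    rise q (0# + 0#) + 1#
      ≈⟨ rise-q (0# + 0#) ⟩
    (0# + 0#) ^ q
      ≈⟨ 0^ 1≤q (+-identityʳ 0#) ⟩
    0# ∎
    where
    0^ : ∀ {n x} → 1 ℕ.≤ n → x ≈ 0# → x ^ n ≈ 0#
    0^ (ℕ.s≤s _) e = trans (*-congʳ e) (zeroˡ _)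

    ∑-head : ∀ n f → (∀ i → i ℕ.< n → f (suc i) ≈ 0#) → ∑ (suc n) f ≈ f 0
    ∑-head n f z = trans (sym (∑-shift n f)) (trans (+-congˡ (∑-zero n z)) (+-identityʳ _))

  -- By `rise-q` this is the power sum Σ (y + i)^(p - 1) = -1. The left side has degree less than p
  -- in y. Periodicity carries its values at 0, ..., p - 1 back to y = 0, where all summands except
  -- i = 0 vanish.
  orbitSum-rise : ∀ y → orbitSum (rise q) y + 1# ≈ 0#
  orbitSum-rise = Deg<-roots p
    (Deg<-+ (Deg<-∑ p p (λ i → Deg<-resp (λ x → ∏-cong q (λ j _ _ → +-assoc x (nat i) (nat j)))
                                          (Deg<-∏ q (λ j → nat i + nat j))))
            (Deg<-const q 1#))
    nat nat-distinct
    (λ {i} _ → trans (+-congʳ (trans (∑-cong p (λ j → rise-cong q (+-congʳ (sym (+-identityˡ (nat i))))))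
                                     (orbitSum-periodic (rise q) (rise-cong q) i 0#)))
                     orbitSum-rise-0)

  orbitSum-rise^p : ∀ y → orbitSum (λ x → rise q x ^ p) y + 1# ≈ 0#
  orbitSum-rise^p y = begin
    ∑ p (λ i → rise q (y + nat i) ^ p) + 1#    ≈⟨ +-cong (frobenius-∑ p _) (1^ p) ⟨
    orbitSum (rise q) y ^ p + 1# ^ p           ≈⟨ frobenius _ _ ⟨
    (orbitSum (rise q) y + 1#) ^ p             ≈⟨ ^-congˡ p (orbitSum-rise y) ⟩
    0# ^ p                                     ≈⟨ 0^p ⟩
    0#                                         ∎

  -- Translation by the prime field preserves the Artin-Schreier relation, so whatever uses it at y
  -- applies to the whole orbit.
  [y+n]^p : ∀ {y c} → y ^ p ≈ y + c → ∀ n → (y + nat n) ^ p ≈ y + nat n + c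
  [y+n]^p {y} {c} e n = begin
    (y + nat n) ^ p     ≈⟨ frobenius y (nat n) ⟩
    y ^ p + nat n ^ p   ≈⟨ +-cong e (nat-^p n) ⟩
    y + c + nat n       ≈⟨ solve 3 (λ y c n → y :+ c :+ n := y :+ n :+ c) refl y c (nat n) ⟩
    y + nat n + c       ∎

  -- Two readings of `superRise (suc p) x`: its last factor is `rise p x` = x^p - x = c, and
  -- `superRise-shift` extracts (x + 1)^p from it.
  superRise-step : ∀ {x c} → x ^ p ≈ x + c → superRise p (x + 1#) * (x + 1#) ^ p ≈ c * superRise p x
  superRise-step {x} {c} e = begin
    superRise p (x + 1#) * (x + 1#) ^ p   ≈⟨ *-comm _ _ ⟩
    (x + 1#) ^ p * superRise p (x + 1#)   ≈⟨ superRise-shift p x ⟨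
    superRise p x * rise p x              ≈⟨ *-comm _ _ ⟩
    rise p x * superRise p x              ≈⟨ *-congʳ rise≈c ⟩
    c * superRise p x                     ∎
    where
    rise≈c : rise p x ≈ c
    rise≈c = +-cancelʳ x _ _ (trans (rise-p x) (trans e (+-comm x c)))

  kernelSum : Carrier → List Carrier → Carrier → Carrier
  kernelSum s ts = orbitSum (λ x → superRise p x * ∏ₗ (x ^ p + s) ts)

  -- kernelSum satisfies the recursion which defines bellFunctional: it is a trace form
  -- representing the functional on F_p[x]/(x^p - x - c).
  kernelSum-bellFunctional : ∀ {y c} → y ^ p ≈ y + c → ∀ s ts →
    kernelSum s ts y ≈ orbitSum (superRise p) y * bellFunctional c s ts
  kernelSum-bellFunctional {y} e s [] =
    trans (∑-cong p (λ i → *-identityʳ _)) (sym (*-identityʳ _))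
  kernelSum-bellFunctional {y} {c} e s (t ∷ ts) = begin
    ∑ p (λ i → P i * ((z i ^ p + s + t) * Π s i))
      ≈⟨ ∑-cong p (λ i → solve 5 (λ P Z s t Π → P :* ((Z :+ s :+ t) :* Π) := P :* Z :* Π :+ (s :+ t) :* (P :* Π))
           refl (P i) (z i ^ p) s t (Π s i)) ⟩
    ∑ p (λ i → P i * z i ^ p * Π s i + (s + t) * (P i * Π s i))
      ≈⟨ trans (∑-+ p _ _) (+-congˡ (∑-*ˡ p (s + t) _)) ⟩
    orbitSum G y + (s + t) * kernelSum s ts y
      ≈⟨ +-congʳ (orbitSum-shift G G-cong y) ⟨
    ∑ p (λ i → G (z i + 1#)) + (s + t) * kernelSum s ts y
      ≈⟨ +-congʳ (trans (∑-cong p G-step) (∑-*ˡ p c _)) ⟩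
    c * kernelSum (1# + s) ts y + (s + t) * kernelSum s ts y
      ≈⟨ +-cong (*-congˡ (kernelSum-bellFunctional e (1# + s) ts)) (*-congˡ (kernelSum-bellFunctional e s ts)) ⟩
    c * (Q * bellFunctional c (1# + s) ts) + (s + t) * (Q * bellFunctional c s ts)
      ≈⟨ solve 6 (λ c Q u s t v → c :* (Q :* u) :+ (s :+ t) :* (Q :* v) := Q :* (c :* u :+ (s :+ t) :* v))
           refl c Q _ s t _ ⟩
    Q * bellFunctional c s (t ∷ ts) ∎
    where
    z P : ℕ → Carrier
    z i = y + nat i
    P i = superRise p (z i)

    Π : Carrier → ℕ → Carrier
    Π s i = ∏ₗ (z i ^ p + s) ts

    Q : Carrier
    Q = orbitSum (superRise p) y

    G : Carrier → Carrier
    G x = superRise p x * x ^ p * ∏ₗ (x ^ p + s) ts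

    G-cong : Congruent G
    G-cong e = *-cong (*-cong (superRise-cong p e) (^-congˡ p e)) (∏ₗ-cong ts (+-congʳ (^-congˡ p e)))

    G-step : ∀ i → G (z i + 1#) ≈ c * (P i * Π (1# + s) i)
    G-step i = begin
      superRise p (z i + 1#) * (z i + 1#) ^ p * ∏ₗ ((z i + 1#) ^ p + s) ts
        ≈⟨ *-cong (superRise-step ([y+n]^p e i))
                  (∏ₗ-cong ts (trans (+-congʳ (trans (frobenius (z i) 1#) (+-congˡ (1^ p)))) (+-assoc _ _ _))) ⟩
      c * P i * Π (1# + s) i
        ≈⟨ *-assoc _ _ _ ⟩
      c * (P i * Π (1# + s) i) ∎

  orbitSum*bellFunctional : ∀ {y c} → y ^ p ≈ y + c → ∀ ts →
    (∀ i → ∏ₗ ((y + nat i) ^ p) ts ≈ hyperRise q (y + nat i)) →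
    orbitSum (superRise p) y * bellFunctional c 0# ts + 1# ≈ 0#
  orbitSum*bellFunctional {y} {c} e ts h = begin
    orbitSum (superRise p) y * bellFunctional c 0# ts + 1#
      ≈⟨ +-congʳ (kernelSum-bellFunctional e 0# ts) ⟨
    kernelSum 0# ts y + 1#
      ≈⟨ +-congʳ (∑-cong p (λ i → trans (*-congˡ (trans (∏ₗ-cong ts (+-identityʳ _)) (h i)))
                                          (superRise*hyperRise q (y + nat i)))) ⟩
    orbitSum (λ x → rise q x ^ p) y + 1#
      ≈⟨ orbitSum-rise^p y ⟩
    0# ∎

  -- On the orbit (y + i)^p = y + i + c, so the shift of every factor by - c restores y + i + j.
  -- This works for all c, in particular for the c = X^p - X that makes Q a unit.
  orbitSum*staircase : ∀ {y c} → y ^ p ≈ y + c →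
    orbitSum (superRise p) y * bellFunctional c 0# (staircase q (- c)) + 1# ≈ 0#
  orbitSum*staircase {y} {c} e = orbitSum*bellFunctional e (staircase q (- c)) λ i → begin
    ∏ₗ ((y + nat i) ^ p) (staircase q (- c))
      ≈⟨ ∏ₗ-staircase q _ (- c) ⟩
    ∏ q (λ j → ((y + nat i) ^ p + (nat j + - c)) ^ j)
      ≈⟨ ∏-cong q (λ j _ _ → ^-congˡ j (shift i j)) ⟩
    hyperRise q (y + nat i) ∎
    where
    shift : ∀ i j → (y + nat i) ^ p + (nat j + - c) ≈ y + nat i + nat j
    shift i j = begin
      (y + nat i) ^ p + (nat j + - c)
        ≈⟨ +-congʳ ([y+n]^p e i) ⟩
      y + nat i + c + (nat j + - c)
        ≈⟨ solve 4 (λ z c j d → z :+ c :+ (j :+ d) := z :+ j :+ (c :+ d)) refl (y + nat i) c (nat j) (- c) ⟩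
      y + nat i + nat j + (c + - c)
        ≈⟨ trans (+-congˡ (-‿inverseʳ c)) (+-identityʳ _) ⟩
      y + nat i + nat j ∎

  orbitSum*hyperfactorial : ∀ {y} → y ^ p ≈ y + 0# →
    orbitSum (superRise p) y * nat (hyperfactorial q) + 1# ≈ 0#
  orbitSum*hyperfactorial {y} e = trans (+-congʳ (*-congˡ (sym eval))) (orbitSum*staircase e)
    where
    eval : bellFunctional 0# 0# (staircase q (- 0#)) ≈ nat (hyperfactorial q)
    eval = begin
      bellFunctional 0# 0# (staircase q (- 0#))   ≈⟨ bellFunctional-zero 0# (staircase q (- 0#)) refl ⟩
      ∏ₗ 0# (staircase q (- 0#))                  ≈⟨ ∏ₗ-staircase q 0# (- 0#) ⟩
      ∏ q (λ j → (0# + (nat j + - 0#)) ^ j)       ≈⟨ ∏-cong q (λ j _ _ → ^-congˡ j (+-congˡ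
                                                       (trans (+-congˡ -0#≈0#) (+-identityʳ _)))) ⟩
      hyperRise q 0#                              ≈⟨ hyperRise-0 q ⟩
      nat (hyperfactorial q)                      ∎

  -- Frobenius moves z by x and fixes the prime field, so m iterations move z by m x. The induction
  -- passes to z + x, which satisfies the same relation.
  ^p^ : ∀ {z x} → z ^ p ≈ z + nat x → ∀ m → z ^ (p ℕ.^ m) ≈ z + nat (m ℕ.* x)
  ^p^ {z} {x} e zero    = trans (*-identityʳ z) (sym (+-identityʳ z))
  ^p^ {z} {x} e (suc m) = begin
    z ^ (p ℕ.* p ℕ.^ m)              ≈⟨ ^-assocʳ z p (p ℕ.^ m) ⟨
    (z ^ p) ^ (p ℕ.^ m)              ≈⟨ ^-congˡ (p ℕ.^ m) e ⟩
    (z + nat x) ^ (p ℕ.^ m)          ≈⟨ ^p^ ([y+n]^p e x) m ⟩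
    z + nat x + nat (m ℕ.* x)        ≈⟨ trans (+-assoc _ _ _) (+-congˡ (sym (nat-+ x (m ℕ.* x)))) ⟩
    z + nat (suc m ℕ.* x)            ∎

  -- This explains τ: after j a applications of Frobenius z has moved by j a x = j, so the summand j
  -- p^(ja - 1), applied as an exponent to z^p, contributes (z + j)^j. The - 1 in its exponent makes
  -- room for the p-th power at which the trace formula evaluates f.
  ^-tau : ∀ {z x a} → 1 ℕ.≤ a → nat (a ℕ.* x) ≈ 1# → z ^ p ≈ z + nat x →
    (z ^ p) ^ tau p a ≈ hyperRise q z
  ^-tau {z} {x} {a} 1≤a ax≈1 e = begin
    (z ^ p) ^ tau p a
      ≈⟨ ^-sumTo (z ^ p) (λ j → j ℕ.* p ℕ.^ (j ℕ.* a ℕ.∸ 1)) ≡.refl q ⟩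
    ∏ q (λ j → (z ^ p) ^ (j ℕ.* p ℕ.^ (j ℕ.* a ℕ.∸ 1)))
      ≈⟨ ∏-cong q (λ j 1≤j _ → step j 1≤j) ⟩
    hyperRise q z ∎
    where
    step : ∀ j → 1 ℕ.≤ j → (z ^ p) ^ (j ℕ.* p ℕ.^ (j ℕ.* a ℕ.∸ 1)) ≈ (z + nat j) ^ j
    step j 1≤j = begin
      (z ^ p) ^ (j ℕ.* p ℕ.^ m)     ≈⟨ ^-assocʳ z p (j ℕ.* p ℕ.^ m) ⟩
      z ^ (p ℕ.* (j ℕ.* p ℕ.^ m))   ≈⟨ ^-congʳ z exponent ⟩
      z ^ (p ℕ.^ (j ℕ.* a) ℕ.* j)   ≈⟨ ^-assocʳ z (p ℕ.^ (j ℕ.* a)) j ⟨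
      (z ^ (p ℕ.^ (j ℕ.* a))) ^ j   ≈⟨ ^-congˡ j (^p^ e (j ℕ.* a)) ⟩
      (z + nat (j ℕ.* a ℕ.* x)) ^ j ≈⟨ ^-congˡ j (+-congˡ jax) ⟩
      (z + nat j) ^ j               ∎
      where
      m : ℕ
      m = j ℕ.* a ℕ.∸ 1

      -- Here j a ≥ 1 is essential: it makes the truncated subtraction in `m` an exact one.
      exponent : p ℕ.* (j ℕ.* p ℕ.^ m) ≡ p ℕ.^ (j ℕ.* a) ℕ.* j
      exponent = ≡.trans (≡.cong (p ℕ.*_) (ℕₚ.*-comm j (p ℕ.^ m))) (≡.trans (≡.sym (ℕₚ.*-assoc p (p ℕ.^ m) j))
        (≡.cong (λ n → p ℕ.^ n ℕ.* j) (ℕₚ.m+[n∸m]≡n {1} (ℕₚ.*-mono-≤ 1≤j 1≤a))))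

      jax : nat (j ℕ.* a ℕ.* x) ≈ nat j
      jax = begin
        nat (j ℕ.* a ℕ.* x)     ≈⟨ nat-cong (ℕₚ.*-assoc j a x) ⟩
        nat (j ℕ.* (a ℕ.* x))   ≈⟨ nat-* j (a ℕ.* x) ⟩
        nat j * nat (a ℕ.* x)   ≈⟨ *-congˡ ax≈1 ⟩
        nat j * 1#              ≈⟨ *-identityʳ _ ⟩
        nat j                   ∎

  orbitSum*bell : ∀ {y x a} → 1 ℕ.≤ a → nat (a ℕ.* x) ≈ 1# → y ^ p ≈ y + nat x →
    orbitSum (superRise p) y * nat (bell (tau p a) x) + 1# ≈ 0#
  orbitSum*bell {y} {x} {a} 1≤a ax≈1 e =
    trans (+-congʳ (*-congˡ (sym (bellFunctional-bell (tau p a) refl))))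
      (orbitSum*bellFunctional e (replicate (tau p a) 0#) λ i → begin
        ∏ₗ ((y + nat i) ^ p) (replicate (tau p a) 0#)   ≈⟨ ∏ₗ-replicate _ (tau p a) 0# ⟩
        ((y + nat i) ^ p + 0#) ^ tau p a                ≈⟨ ^-congˡ (tau p a) (+-identityʳ _) ⟩
        ((y + nat i) ^ p) ^ tau p a                     ≈⟨ ^-tau 1≤a ax≈1 ([y+n]^p e i) ⟩
        hyperRise q (y + nat i)                         ∎)

-- The polynomial ring in one variable

module PolynomialRing {a ℓ} (R : CommutativeRing a ℓ) where
  open RingLemmas R

  conv : (ℕ → Carrier) → (ℕ → Carrier) → ℕ → Carrier
  conv f g zero    = f 0 * g 0
  conv f g (suc n) = f 0 * g (suc n) + conv (f ∘ suc) g n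

  conv-cong : ∀ {f f′ g g′} → (∀ n → f n ≈ f′ n) → (∀ n → g n ≈ g′ n) → ∀ n → conv f g n ≈ conv f′ g′ n
  conv-cong e e′ zero    = *-cong (e 0) (e′ 0)
  conv-cong e e′ (suc n) = +-cong (*-cong (e 0) (e′ (suc n))) (conv-cong (e ∘ suc) e′ n)

  -- The recursion of `conv` peels off the summand with `f 0`; commutativity needs the opposite end
  -- as well.
  conv-snoc : ∀ f g n → conv f g (suc n) ≈ conv f (g ∘ suc) n + f (suc n) * g 0
  conv-snoc f g zero    = refl
  conv-snoc f g (suc n) = trans (+-congˡ (conv-snoc (f ∘ suc) g n)) (sym (+-assoc _ _ _))

  conv-comm : ∀ f g n → conv f g n ≈ conv g f n
  conv-comm f g zero    = *-comm _ _
  conv-comm f g (suc n) = begin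
    f 0 * g (suc n) + conv (f ∘ suc) g n    ≈⟨ +-cong (*-comm _ _) (conv-comm (f ∘ suc) g n) ⟩
    g (suc n) * f 0 + conv g (f ∘ suc) n    ≈⟨ +-comm _ _ ⟩
    conv g (f ∘ suc) n + g (suc n) * f 0    ≈⟨ conv-snoc g f n ⟨
    conv g f (suc n)                        ∎

  conv-distribʳ : ∀ f g h n → conv (λ i → g i + h i) f n ≈ conv g f n + conv h f n
  conv-distribʳ f g h zero    = distribʳ _ _ _
  conv-distribʳ f g h (suc n) = trans (+-congˡ (conv-distribʳ f (g ∘ suc) (h ∘ suc) n))
    (solve 5 (λ a b c d e → (a :+ b) :* c :+ (d :+ e) := a :* c :+ d :+ (b :* c :+ e)) refl _ _ _ _ _)

  conv-*ˡ : ∀ b f g n → conv (λ i → b * f i) g n ≈ b * conv f g n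
  conv-*ˡ b f g zero    = *-assoc _ _ _
  conv-*ˡ b f g (suc n) = trans (+-cong (*-assoc _ _ _) (conv-*ˡ b (f ∘ suc) g n)) (sym (distribˡ _ _ _))

  conv-assoc : ∀ f g h n → conv (conv f g) h n ≈ conv f (conv g h) n
  conv-assoc f g h zero    = *-assoc _ _ _
  conv-assoc f g h (suc n) = begin
    f 0 * g 0 * h (suc n) + conv (λ i → f 0 * g (suc i) + conv (f ∘ suc) g i) h n
      ≈⟨ +-cong (*-assoc _ _ _) (trans (conv-distribʳ h (λ i → f 0 * g (suc i)) (conv (f ∘ suc) g) n)
           (+-cong (conv-*ˡ (f 0) (g ∘ suc) h n) (conv-assoc (f ∘ suc) g h n))) ⟩
    f 0 * (g 0 * h (suc n)) + (f 0 * conv (g ∘ suc) h n + conv (f ∘ suc) (conv g h) n)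
      ≈⟨ trans (sym (+-assoc _ _ _)) (+-congʳ (sym (distribˡ _ _ _))) ⟩
    f 0 * conv g h (suc n) + conv (f ∘ suc) (conv g h) n ∎

  VanishesFrom : ℕ → (ℕ → Carrier) → Set ℓ
  VanishesFrom d f = ∀ n → d ℕ.≤ n → f n ≈ 0#

  conv-zeroˡ : ∀ {f} g → VanishesFrom 0 f → VanishesFrom 0 (conv f g)
  conv-zeroˡ g z zero    _ = trans (*-congʳ (z 0 ℕ.z≤n)) (zeroˡ _)
  conv-zeroˡ g z (suc n) _ = trans
    (+-cong (trans (*-congʳ (z 0 ℕ.z≤n)) (zeroˡ _)) (conv-zeroˡ g (λ i _ → z (suc i) ℕ.z≤n) n ℕ.z≤n))
    (+-identityʳ 0#)

  conv-vanishes : ∀ {f g} d e → VanishesFrom d f → VanishesFrom e g → VanishesFrom (d ℕ.+ e) (conv f g)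
  conv-vanishes {f} {g} zero e z z′ n _ = conv-zeroˡ g z n ℕ.z≤n
  conv-vanishes (suc d) e z z′ (suc n) (ℕ.s≤s d+e≤n) = trans
    (+-cong (trans (*-congˡ (z′ (suc n) (ℕₚ.m≤n⇒m≤1+n (ℕₚ.m+n≤o⇒n≤o d d+e≤n)))) (zeroʳ _))
            (conv-vanishes d e (λ i d≤i → z (suc i) (ℕ.s≤s d≤i)) z′ n d+e≤n))
    (+-identityʳ 0#)

  conv-leading : ∀ {f g} d e → VanishesFrom (suc d) f → VanishesFrom (suc e) g → conv f g (d ℕ.+ e) ≈ f d * g e
  conv-leading zero zero z z′ = refl
  conv-leading {f} {g} zero (suc e) z z′ = trans
    (+-congˡ (conv-zeroˡ g (λ i _ → z (suc i) (ℕ.s≤s ℕ.z≤n)) e ℕ.z≤n)) (+-identityʳ _)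
  conv-leading {f} {g} (suc d) e z z′ = trans
    (+-cong (trans (*-congˡ (z′ (suc (d ℕ.+ e)) (ℕ.s≤s (ℕₚ.m≤n+m e d)))) (zeroʳ _))
            (conv-leading d e (λ i d≤i → z (suc i) (ℕ.s≤s d≤i)) z′))
    (+-identityˡ _)

  -- `bound` is some index from which on all coefficients vanish, not the degree. The ring
  -- operations thus avoid zero tests, and `_≋_` ignores the bound.
  record Poly : Set (a ⊔ ℓ) where
    no-eta-equality
    constructor poly
    field
      coeff  : ℕ → Carrier
      bound  : ℕ
      vanish : VanishesFrom bound coeff
  open Poly public

  infix 4 _≋_
  record _≋_ (f g : Poly) : Set ℓ where
    no-eta-equality
    constructor pointwise
    field coeff-≈ : ∀ n → coeff f n ≈ coeff g n
  open _≋_ public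

  constCoeff : Carrier → ℕ → Carrier
  constCoeff b zero    = b
  constCoeff b (suc n) = 0#

  const : Carrier → Poly
  const b = poly (constCoeff b) 1 λ { (suc n) _ → refl }

  polynomialRing : CommutativeRing _ _
  polynomialRing = record
    { Carrier = Poly
    ; _≈_     = _≋_
    ; _+_     = add
    ; _*_     = mul
    ; -_      = neg
    ; 0#      = const 0#
    ; 1#      = const 1#
    ; isCommutativeRing = record
      { isRing = record
        { +-isAbelianGroup = record
          { isGroup = record
            { isMonoid = record
              { isSemigroup = record
                { isMagma = record
                  { isEquivalence = record
                    { refl  = pointwise λ n → refl
                    ; sym   = λ e → pointwise λ n → sym (coeff-≈ e n)
                    ; trans = λ e e′ → pointwise λ n → trans (coeff-≈ e n) (coeff-≈ e′ n)
                    }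
                  ; ∙-cong = λ e e′ → pointwise λ n → +-cong (coeff-≈ e n) (coeff-≈ e′ n)
                  }
                ; assoc = λ f g h → pointwise λ n → +-assoc _ _ _
                }
              ; identity = (λ f → pointwise λ n → trans (+-congʳ (const-0 n)) (+-identityˡ _)) ,
                           (λ f → pointwise λ n → trans (+-congˡ (const-0 n)) (+-identityʳ _))
              }
            ; inverse = (λ f → pointwise λ n → trans (-‿inverseˡ _) (sym (const-0 n))) ,
                        (λ f → pointwise λ n → trans (-‿inverseʳ _) (sym (const-0 n)))
            ; ⁻¹-cong = λ e → pointwise λ n → -‿cong (coeff-≈ e n)
            }
          ; comm = λ f g → pointwise λ n → +-comm _ _
          }
        ; *-cong = λ e e′ → pointwise (conv-cong (coeff-≈ e) (coeff-≈ e′))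
        ; *-assoc = λ f g h → pointwise (conv-assoc (coeff f) (coeff g) (coeff h))
        ; *-identity = (λ f → pointwise (conv-1 f)) ,
                       (λ f → pointwise λ n → trans (conv-comm (coeff f) (constCoeff 1#) n) (conv-1 f n))
        ; distrib = (λ f g h → pointwise λ n → trans (conv-comm (coeff f) (coeff (add g h)) n)
                       (trans (conv-distribʳ (coeff f) (coeff g) (coeff h) n)
                              (+-cong (conv-comm (coeff g) (coeff f) n) (conv-comm (coeff h) (coeff f) n)))) ,
                    (λ f g h → pointwise (conv-distribʳ (coeff f) (coeff g) (coeff h)))
        }
      ; *-comm = λ f g → pointwise (conv-comm (coeff f) (coeff g))
      }
    }
    where
    const-0 : ∀ n → constCoeff 0# n ≈ 0#
    const-0 zero    = refl
    const-0 (suc n) = refl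

    add mul : Poly → Poly → Poly
    add f g = poly (λ n → coeff f n + coeff g n) (bound f ℕ.⊔ bound g) λ n b≤n → trans
      (+-cong (vanish f n (ℕₚ.≤-trans (ℕₚ.m≤m⊔n (bound f) (bound g)) b≤n))
              (vanish g n (ℕₚ.≤-trans (ℕₚ.m≤n⊔m (bound f) (bound g)) b≤n))) (+-identityʳ 0#)
    mul f g = poly (conv (coeff f) (coeff g)) (bound f ℕ.+ bound g)
      (conv-vanishes (bound f) (bound g) (vanish f) (vanish g))

    neg : Poly → Poly
    neg f = poly (λ n → - coeff f n) (bound f) λ n b≤n → trans (-‿cong (vanish f n b≤n)) -0#≈0#

    conv-1 : ∀ f n → conv (constCoeff 1#) (coeff f) n ≈ coeff f n
    conv-1 f zero    = *-identityˡ _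
    conv-1 f (suc n) = trans (+-cong (*-identityˡ _) (conv-zeroˡ (coeff f) (λ _ _ → refl) n ℕ.z≤n)) (+-identityʳ _)

  private
    module P = RingLemmas polynomialRing

  const-cong : ∀ {b c} → b ≈ c → const b ≋ const c
  const-cong e = pointwise λ { zero → e ; (suc n) → refl }

  const-+ : ∀ b c → const (b + c) ≋ const b P.+ const c
  const-+ b c = pointwise λ { zero → refl ; (suc n) → sym (+-identityʳ 0#) }

  const-* : ∀ b c → const (b * c) ≋ const b P.* const c
  const-* b c = pointwise λ
    { zero    → refl
    ; (suc n) → sym (trans (+-cong (zeroʳ b) (conv-zeroˡ (constCoeff c) (λ _ _ → refl) n ℕ.z≤n)) (+-identityʳ 0#))
    }

  const-nat : ∀ n → const (nat n) ≋ P.nat n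
  const-nat zero    = P.refl
  const-nat (suc n) = P.trans (const-+ 1# (nat n)) (P.+-congˡ {const 1#} (const-nat n))

  X : Poly
  X = poly XCoeff 2 λ { (suc (suc n)) _ → refl ; (suc zero) (ℕ.s≤s ()) }
    where
    XCoeff : ℕ → Carrier
    XCoeff zero    = 0#
    XCoeff (suc n) = constCoeff 1# n

  coeff-X* : ∀ f n → coeff (X P.* f) (suc n) ≈ coeff f n
  coeff-X* f n = trans (+-cong (zeroˡ _) (coeff-≈ (P.*-identityˡ f) n)) (+-identityˡ _)

  coeff-X^ : ∀ n → coeff (X P.^ n) n ≈ 1#
  coeff-X^ zero    = refl
  coeff-X^ (suc n) = trans (coeff-X* (X P.^ n) n) (coeff-X^ n)

  X^-vanishes : ∀ n → VanishesFrom (suc n) (coeff (X P.^ n))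
  X^-vanishes zero    (suc m) _           = refl
  X^-vanishes (suc n) (suc m) (ℕ.s≤s n<m) = trans (coeff-X* (X P.^ n) m) (X^-vanishes n m n<m)

-- Quotients by a principal ideal

module PrincipalQuotient {a ℓ} (R : CommutativeRing a ℓ) (g : CommutativeRing.Carrier R) where
  open RingLemmas R

  infix 4 _≈ᵍ_
  -- The quotient keeps the carrier and coarsens equality, with an explicit multiplier as witness.
  -- It serves both for ℤ/p and for the Artin-Schreier quotients of F_p[X].
  record _≈ᵍ_ (x y : Carrier) : Set (a ⊔ ℓ) where
    no-eta-equality
    pattern
    constructor mod
    field
      multiplier : Carrier
      equation   : x ≈ y + multiplier * g

  ≈⇒≈ᵍ : ∀ {x y} → x ≈ y → x ≈ᵍ y
  ≈⇒≈ᵍ e = mod 0# (trans e (sym (trans (+-congˡ (zeroˡ g)) (+-identityʳ _))))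

  neg-shift : ∀ y h → - (y + h * g) ≈ - y + - h * g
  neg-shift y h = trans (sym (-‿+-comm y (h * g))) (+-congˡ (-‿distribˡ-* h g))

  quotientRing : CommutativeRing _ _
  quotientRing = record
    { Carrier = Carrier
    ; _≈_     = _≈ᵍ_
    ; _+_     = _+_
    ; _*_     = _*_
    ; -_      = -_
    ; 0#      = 0#
    ; 1#      = 1#
    ; isCommutativeRing = record
      { isRing = record
        { +-isAbelianGroup = record
          { isGroup = record
            { isMonoid = record
              { isSemigroup = record
                { isMagma = record
                  { isEquivalence = record
                    { refl  = ≈⇒≈ᵍ refl
                    ; sym   = λ { {x} {y} (mod h e) → mod (- h) (begin
                        y                      ≈⟨ +-identityʳ y ⟨
                        y + 0#                 ≈⟨ +-congˡ (trans (*-congʳ (-‿inverseʳ h)) (zeroˡ g)) ⟨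
                        y + (h + - h) * g      ≈⟨ solve 4 (λ y h k g → y :+ (h :+ k) :* g := y :+ h :* g :+ k :* g) refl y h (- h) g ⟩
                        y + h * g + - h * g    ≈⟨ +-congʳ e ⟨
                        x + - h * g            ∎) }
                    ; trans = λ { {x} {y} {z} (mod h e) (mod k e′) → mod (k + h) (trans e (trans (+-congʳ e′)
                        (solve 4 (λ z h k g → z :+ k :* g :+ h :* g := z :+ (k :+ h) :* g) refl z h k g))) }
                    }
                  ; ∙-cong = λ { {x} {y} {u} {v} (mod h e) (mod k e′) → mod (h + k) (trans (+-cong e e′)
                      (solve 5 (λ y h v k g → y :+ h :* g :+ (v :+ k :* g) := y :+ v :+ (h :+ k) :* g) refl y h v k g)) }
                  }
                ; assoc = λ x y z → ≈⇒≈ᵍ (+-assoc x y z)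
                }
              ; identity = (λ x → ≈⇒≈ᵍ (+-identityˡ x)) , (λ x → ≈⇒≈ᵍ (+-identityʳ x))
              }
            ; inverse = (λ x → ≈⇒≈ᵍ (-‿inverseˡ x)) , (λ x → ≈⇒≈ᵍ (-‿inverseʳ x))
            ; ⁻¹-cong = λ { {x} {y} (mod h e) → mod (- h) (trans (-‿cong e) (neg-shift y h)) }
            }
          ; comm = λ x y → ≈⇒≈ᵍ (+-comm x y)
          }
        ; *-cong = λ { {x} {y} {u} {v} (mod h e) (mod k e′) → mod (y * k + h * v + h * k * g) (trans (*-cong e e′)
            (solve 5 (λ y h v k g → (y :+ h :* g) :* (v :+ k :* g) :=
                y :* v :+ (y :* k :+ h :* v :+ h :* k :* g) :* g) refl y h v k g)) }
        ; *-assoc = λ x y z → ≈⇒≈ᵍ (*-assoc x y z)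
        ; *-identity = (λ x → ≈⇒≈ᵍ (*-identityˡ x)) , (λ x → ≈⇒≈ᵍ (*-identityʳ x))
        ; distrib = (λ x y z → ≈⇒≈ᵍ (distribˡ x y z)) , (λ x y z → ≈⇒≈ᵍ (distribʳ x y z))
        }
      ; *-comm = λ x y → ≈⇒≈ᵍ (*-comm x y)
      }
    }

  private
    module Q = RingLemmas quotientRing

  -- The quotient has the operations of R, but whatever is defined by recursion over them exists
  -- once per ring; the copies are identified by induction.
  quotient-nat : ∀ n → Q.nat n ≡ nat n
  quotient-nat zero    = ≡.refl
  quotient-nat (suc n) = ≡.cong (1# +_) (quotient-nat n)

  quotient-^ : ∀ x n → x Q.^ n ≡ x ^ n
  quotient-^ x zero    = ≡.refl
  quotient-^ x (suc n) = ≡.cong (x *_) (quotient-^ x n)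

  quotient-∑ : ∀ n {f f′ : ℕ → Carrier} → (∀ i → f i ≡ f′ i) → Q.∑ n f ≡ ∑ n f′
  quotient-∑ zero    e = ≡.refl
  quotient-∑ (suc n) e = ≡.cong₂ _+_ (quotient-∑ n e) (e n)

  quotient-rise : ∀ n x → Q.rise n x ≡ rise n x
  quotient-rise zero    x = ≡.refl
  quotient-rise (suc n) x = ≡.cong₂ _*_ (quotient-rise n x) (≡.cong (x +_) (quotient-nat (suc n)))

  quotient-superRise : ∀ n x → Q.superRise n x ≡ superRise n x
  quotient-superRise zero    x = ≡.refl
  quotient-superRise (suc n) x = ≡.cong₂ _*_ (quotient-superRise n x) (quotient-rise n x)

-- Modelled on A = F[X] for a field F.
record IsPolynomialExtension {a ℓ b m} (F : CommutativeRing a ℓ) (A : CommutativeRing b m) : Set (a ⊔ ℓ ⊔ b ⊔ m) where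
  private
    module F = RingLemmas F
    module A = RingLemmas A
  field
    X             : A.Carrier
    const         : F.Carrier → A.Carrier
    const-cong    : ∀ {b c} → b F.≈ c → const b A.≈ const c
    const-+       : ∀ b c → const (b F.+ c) A.≈ const b A.+ const c
    const-*       : ∀ b c → const (b F.* c) A.≈ const b A.* const c
    const-nat     : ∀ n → const (F.nat n) A.≈ A.nat n
    unit-constant : ∀ f g → f A.* g A.+ A.1# A.≈ A.0# → ∃ λ k → f A.≈ const k
    trinomial-faithful : ∀ {n} → 2 ℕ.≤ n → ∀ c h k →
      const k A.≈ h A.* (X A.^ n A.- (X A.+ const c)) → k F.≈ F.0#

-- Degrees, units and constants in principal ideals

module PolynomialDegree {a ℓ} (F : CommutativeRing a ℓ)
    (≈0? : RingLemmas.DecidableZero F) (integral : RingLemmas.NoZeroDivisors F)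
    (1≉0 : RingLemmas.Nontrivial F) where

  open RingLemmas F
  open PolynomialRing F
  private
    module P = RingLemmas polynomialRing

  HasDegree : Poly → ℕ → Set ℓ
  HasDegree f d = ¬ (coeff f d ≈ 0#) × VanishesFrom (suc d) (coeff f)

  degree : ∀ f → VanishesFrom 0 (coeff f) ⊎ ∃ (HasDegree f)
  degree f = search (bound f) (vanish f)
    where
    search : ∀ b → VanishesFrom b (coeff f) → VanishesFrom 0 (coeff f) ⊎ ∃ (HasDegree f)
    search zero    z = inj₁ z
    search (suc b) z with ≈0? (coeff f b)
    ... | no  fb≉0 = inj₂ (b , fb≉0 , z)
    ... | yes fb≈0 = search b λ n b≤n → vanish-at (ℕₚ.m≤n⇒m<n∨m≡n b≤n)
      where
      vanish-at : ∀ {n} → b ℕ.< n ⊎ b ≡ n → coeff f n ≈ 0#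
      vanish-at (inj₁ b<n)    = z _ b<n
      vanish-at (inj₂ ≡.refl) = fb≈0

  degree-* : ∀ f g {d e} → HasDegree f d → HasDegree g e → ¬ (coeff (f P.* g) (d ℕ.+ e) ≈ 0#)
  degree-* f g {d} {e} (fd≉0 , z) (ge≉0 , z′) fg≈0
    with integral _ _ (trans (sym (conv-leading {coeff f} {coeff g} d e z z′)) fg≈0)
  ... | inj₁ fd≈0 = fd≉0 fd≈0
  ... | inj₂ ge≈0 = ge≉0 ge≈0

  -- Degrees add over a domain and f g = -1 has degree 0, so f has degree 0 too.
  unit-constant : ∀ f g → f P.* g P.+ P.1# ≋ P.0# → f ≋ const (coeff f 0)
  unit-constant f g e with degree f | degree g
  ... | inj₁ f≈0 | _ = contradiction
    (trans (sym (trans (+-congʳ (conv-zeroˡ (coeff g) f≈0 0 ℕ.z≤n)) (+-identityˡ 1#))) (coeff-≈ e 0)) 1≉0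
  ... | inj₂ _ | inj₁ g≈0 = contradiction
    (trans (sym (trans (+-congʳ (trans (conv-comm (coeff f) (coeff g) 0) (conv-zeroˡ (coeff f) g≈0 0 ℕ.z≤n)))
                      (+-identityˡ 1#))) (coeff-≈ e 0)) 1≉0
  ... | inj₂ (d , hd@(_ , z)) | inj₂ (e′ , he) = pointwise λ
    { zero    → refl
    ; (suc n) → z (suc n) (≡.subst (ℕ._≤ suc n) (≡.cong suc (≡.sym d≡0)) (ℕ.s≤s ℕ.z≤n))
    }
    where
    fg-constant : ∀ n → 1 ℕ.≤ n → coeff (f P.* g) n ≈ 0#
    fg-constant (suc n) _ = trans (sym (+-identityʳ _)) (coeff-≈ e (suc n))

    d≡0 : d ≡ 0
    d≡0 with d ℕ.+ e′ in eq
    ... | zero  = ℕₚ.m+n≡0⇒m≡0 d eq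
    ... | suc n = contradiction (≡.subst (λ m → coeff (f P.* g) m ≈ 0#) (≡.sym eq) (fg-constant (suc n) (ℕ.s≤s ℕ.z≤n)))
                                (degree-* f g hd he)

  -- A nonzero multiple of g has degree at least d ≥ 1. Hence the coefficient field embeds in the
  -- quotient by g.
  const∈ideal : ∀ g {d} → 1 ℕ.≤ d → HasDegree g d → ∀ h k → const k ≋ h P.* g → k ≈ 0#
  const∈ideal g {d} 1≤d hg h k e with degree h
  ... | inj₁ h≈0 = trans (coeff-≈ e 0) (conv-zeroˡ (coeff g) h≈0 0 ℕ.z≤n)
  ... | inj₂ (d′ , hh) = contradiction (trans (sym (coeff-≈ e (d′ ℕ.+ d))) (zero-at (ℕₚ.≤-trans 1≤d (ℕₚ.m≤n+m d d′))))
                                       (degree-* h g hh hg)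
    where
    zero-at : ∀ {n} → 1 ℕ.≤ n → coeff (const k) n ≈ 0#
    zero-at (ℕ.s≤s _) = refl

  trinomial-degree : ∀ {q} → 1 ℕ.≤ q → ∀ c → HasDegree (X P.^ suc q P.- (X P.+ const c)) (suc q)
  trinomial-degree {q} 1≤q c = nonzero , λ n p<n → trans
      (+-cong (X^-vanishes (suc q) n p<n) (low n (ℕₚ.≤-trans (ℕ.s≤s 1≤q) (ℕₚ.<⇒≤ p<n)))) (+-identityʳ 0#)
    where
    low : ∀ n → 2 ℕ.≤ n → - coeff (X P.+ const c) n ≈ 0#
    low (suc (suc n)) _ = trans (-‿cong (+-identityʳ 0#)) -0#≈0#
    low (suc zero) (ℕ.s≤s ())

    nonzero : ¬ (coeff (X P.^ suc q P.- (X P.+ const c)) (suc q) ≈ 0#)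
    nonzero e = 1≉0 (trans (sym (trans (+-cong (coeff-X^ (suc q)) (low (suc q) (ℕ.s≤s 1≤q))) (+-identityʳ 1#))) e)

  isPolynomialExtension : IsPolynomialExtension F polynomialRing
  isPolynomialExtension = record
    { X = X ; const = const ; const-cong = const-cong ; const-+ = const-+ ; const-* = const-* ; const-nat = const-nat
    ; unit-constant = λ f g e → coeff f 0 , unit-constant f g e
    ; trinomial-faithful = λ { {suc n} (ℕ.s≤s 1≤n) c →
        const∈ideal (X P.^ suc n P.- (X P.+ const c)) (ℕ.s≤s ℕ.z≤n) (trinomial-degree 1≤n c) }
    }

-- Comparison of the Artin-Schreier quotients

module BellModP {a ℓ b m} {F : CommutativeRing a ℓ} {A : CommutativeRing b m} (F[X] : IsPolynomialExtension F A)
    (q : ℕ) (p-prime : Prime (suc q)) (char : RingLemmas.HasCharacteristic F (suc q)) where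

  open RingLemmas F
  open RingLemmas A using () renaming
    (Carrier to Poly; _≈_ to _≋_; _+_ to _⊕_; _*_ to _⊗_; _-_ to _⊖_; 0# to 𝟘; 1# to 𝟙; _^_ to _⊗^_; nat to natᴬ)
  open IsPolynomialExtension F[X]

  private
    p : ℕ
    p = suc q

    module P = RingLemmas A

  P-char : natᴬ p ≋ 𝟘
  P-char = P.trans (P.sym (const-nat p)) (P.trans (const-cong char) (const-nat 0))

  private
    module C = CharP A q p-prime P-char

  total : Poly
  total = C.orbitSum (P.superRise p) X

  -- For y = X the choice c = X^p - X turns y^p = y + c into a tautology, and `C.orbitSum*staircase`
  -- then exhibits `total` as a unit.
  total-constant : ∃ λ k → total ≋ const k
  total-constant = unit-constant total _ (C.orbitSum*staircase (P.x≈y+[x-y] (X ⊗^ p) X))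

  total₀ : Carrier
  total₀ = proj₁ total-constant

  module ArtinSchreier (c : Carrier) where
    trinomial : Poly
    trinomial = X ⊗^ p ⊖ (X ⊕ const c)

    open PrincipalQuotient A trinomial public
    module Q = RingLemmas quotientRing

    Q-char : Q.nat p Q.≈ Q.0#
    Q-char = Q.trans (Q.reflexive (quotient-nat p)) (≈⇒≈ᵍ P-char)

    module D = CharP quotientRing q p-prime Q-char

    X^p : X Q.^ p Q.≈ X Q.+ const c
    X^p = Q.trans (Q.reflexive (quotient-^ X p))
      (mod 𝟙 (P.trans (P.x≈y+[x-y] (X ⊗^ p) (X ⊕ const c)) (P.+-congˡ (P.sym (P.*-identityˡ trinomial)))))

    Q-total : D.orbitSum (Q.superRise p) X ≡ total
    Q-total = quotient-∑ p λ i → ≡.trans (quotient-superRise p _) (≡.cong (λ z → P.superRise p (X ⊕ z)) (quotient-nat i))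

    total≈ : D.orbitSum (Q.superRise p) X Q.≈ const total₀
    total≈ = Q.trans (Q.reflexive Q-total) (≈⇒≈ᵍ (proj₂ total-constant))

    nat≈ : ∀ n → Q.nat n Q.≈ const (nat n)
    nat≈ n = Q.trans (Q.reflexive (quotient-nat n)) (≈⇒≈ᵍ (P.sym (const-nat n)))

    -- In the quotient `total` is the constant `total₀`, so the left side is represented by a
    -- constant polynomial; a constant in the ideal of `trinomial` is zero.
    descend : ∀ n → D.orbitSum (Q.superRise p) X Q.* Q.nat n Q.+ Q.1# Q.≈ Q.0# → total₀ * nat n + 1# ≈ 0#
    descend n e = conclude (Q.*+1-cong (Q.sym total≈) (Q.sym (nat≈ n)) e)
      where
      const-1 : const 1# ≋ 𝟙
      const-1 = P.trans (const-cong (sym nat-1)) (P.trans (const-nat 1) P.nat-1)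

      expand : const (total₀ * nat n + 1#) ≋ const total₀ ⊗ const (nat n) ⊕ 𝟙
      expand = P.trans (const-+ (total₀ * nat n) 1#) (P.+-cong (const-* total₀ (nat n)) const-1)

      conclude : const total₀ ⊗ const (nat n) ⊕ 𝟙 ≈ᵍ 𝟘 → total₀ * nat n + 1# ≈ 0#
      conclude (mod h e) = trinomial-faithful (ℕ.s≤s C.1≤q) c h (total₀ * nat n + 1#) (P.trans expand (P.trans e (P.+-identityˡ _)))

  inverse-unique : ∀ {x y z} → x * y + 1# ≈ 0# → x * z + 1# ≈ 0# → y ≈ z
  inverse-unique {x} {y} {z} e e′ = begin
    y                         ≈⟨ *-identityˡ y ⟨
    1# * y                    ≈⟨ +-cancelʳ (x * y * z) _ _ (begin
      1# * y + x * y * z        ≈⟨ solve 3 (λ x y z → con 1 :* y :+ x :* y :* z := (x :* z :+ con 1) :* y) refl x y z ⟩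
      (x * z + 1#) * y          ≈⟨ trans (*-congʳ e′) (zeroˡ y) ⟩
      0#                        ≈⟨ trans (*-congʳ e) (zeroˡ z) ⟨
      (x * y + 1#) * z          ≈⟨ solve 3 (λ x y z → (x :* y :+ con 1) :* z := con 1 :* z :+ x :* y :* z) refl x y z ⟩
      1# * z + x * y * z        ∎) ⟩
    1# * z                    ≈⟨ *-identityˡ z ⟩
    z                         ∎

  -- The quotients for c = x and for c = 0 share the scalar `total₀`, and each side is its inverse
  -- up to sign.
  bell-tau : ∀ {x a} → 1 ℕ.≤ a → nat (a ℕ.* x) ≈ 1# → nat (bell (tau p a) x) ≈ nat (hyperfactorial q)
  bell-tau {x} {a} 1≤a ax≈1 = inverse-unique bell-inverse hyperfactorial-inverse
    where
    bell-inverse : total₀ * nat (bell (tau p a) x) + 1# ≈ 0#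
    bell-inverse = descend (bell (tau p a) x) (D.orbitSum*bell 1≤a ax (Q.trans X^p (Q.+-congˡ (Q.sym (nat≈ x)))))
      where
      open ArtinSchreier (nat x)

      ax : Q.nat (a ℕ.* x) Q.≈ Q.1#
      ax = Q.trans (nat≈ (a ℕ.* x)) (Q.trans (≈⇒≈ᵍ (const-cong (trans ax≈1 (sym nat-1)))) (Q.trans (Q.sym (nat≈ 1)) Q.nat-1))

    hyperfactorial-inverse : total₀ * nat (hyperfactorial q) + 1# ≈ 0#
    hyperfactorial-inverse = descend (hyperfactorial q)
      (D.orbitSum*hyperfactorial (Q.trans X^p (Q.+-congˡ (≈⇒≈ᵍ (const-nat 0)))))
      where
      open ArtinSchreier 0#

-- The value of Π j^j modulo an odd prime, and Euler's criterion

halves : ∀ n → ∃ λ m → n ≡ m ℕ.+ m ⊎ n ≡ m ℕ.+ suc m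
halves zero = 0 , inj₁ ≡.refl
halves (suc n) with halves n
... | m , inj₁ ≡.refl = m , inj₂ (≡.sym (ℕₚ.+-suc m m))
... | m , inj₂ ≡.refl = suc m , inj₁ ≡.refl

module OddPrimeField {a ℓ} (F : CommutativeRing a ℓ)
    (integral : RingLemmas.NoZeroDivisors F) (1≉0 : RingLemmas.Nontrivial F)
    (h : ℕ) (p-prime : Prime (suc (h ℕ.+ h))) (char : RingLemmas.HasCharacteristic F (suc (h ℕ.+ h))) where

  open RingLemmas F
  open CharP F (h ℕ.+ h) p-prime char

  x+y≈0⇒x≈-y : ∀ {x y} → x + y ≈ 0# → x ≈ - y
  x+y≈0⇒x≈-y {x} {y} e = +-cancelʳ y _ _ (trans e (sym (-‿inverseˡ y)))

  nat-complement : ∀ {i j} → i ℕ.+ j ≡ p → nat i ≈ - nat j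
  nat-complement {i} {j} e = x+y≈0⇒x≈-y (trans (sym (nat-+ i j)) (trans (nat-cong e) char))

  -1*-1 : - 1# * - 1# ≈ 1#
  -1*-1 = trans (sym (-‿distribˡ-* 1# (- 1#))) (trans (-‿cong (*-identityˡ _)) (-‿involutive 1#))

  -1*x : ∀ x → - 1# * x ≈ - x
  -1*x x = trans (sym (-‿distribˡ-* 1# x)) (-‿cong (*-identityˡ x))

  -1^[n+n] : ∀ n → (- 1#) ^ (n ℕ.+ n) ≈ 1#
  -1^[n+n] zero = refl
  -1^[n+n] (suc n) rewrite ℕₚ.+-suc n n = begin
    - 1# * (- 1# * (- 1#) ^ (n ℕ.+ n))   ≈⟨ *-assoc _ _ _ ⟨
    - 1# * - 1# * (- 1#) ^ (n ℕ.+ n)     ≈⟨ *-cong -1*-1 (-1^[n+n] n) ⟩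
    1# * 1#                              ≈⟨ *-identityˡ 1# ⟩
    1#                                   ∎

  -- As p is odd, i and j have opposite parity.
  -1^complement : ∀ {i j} → i ℕ.+ j ≡ p → (- 1#) ^ i ≈ (- 1#) ^ suc j
  -1^complement {i} {j} e = begin
    s ^ i                        ≈⟨ *-identityʳ _ ⟨
    s ^ i * 1#                   ≈⟨ *-congˡ (-1^[n+n] j) ⟨
    s ^ i * s ^ (j ℕ.+ j)        ≈⟨ *-congˡ (^-homo-* s j j) ⟩
    s ^ i * (s ^ j * s ^ j)      ≈⟨ *-assoc _ _ _ ⟨
    s ^ i * s ^ j * s ^ j        ≈⟨ *-congʳ (^-homo-* s i j) ⟨
    s ^ (i ℕ.+ j) * s ^ j        ≈⟨ *-congʳ (^-congʳ s e) ⟩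
    s ^ p * s ^ j                ≈⟨ *-congʳ (trans (*-congˡ (-1^[n+n] h)) (*-identityʳ s)) ⟩
    s * s ^ j                    ∎
    where
    s : Carrier
    s = - 1#

  signed : ℕ → Carrier
  signed j = (- 1#) ^ suc j * nat j

  -- From i = -j modulo p the product is (-1)^i j^(i + j) = (-1)^i j^p, and Fermat reduces j^p to j.
  fold-term : ∀ i j → i ℕ.+ j ≡ p → nat j ^ j * nat i ^ i ≈ signed j
  fold-term i j e = begin
    nat j ^ j * nat i ^ i
      ≈⟨ *-congˡ (^-congˡ i (trans (nat-complement {i} {j} e) (sym (-1*x (nat j))))) ⟩
    nat j ^ j * (- 1# * nat j) ^ i
      ≈⟨ *-congˡ (^-distrib-* (- 1#) (nat j) i) ⟩
    nat j ^ j * ((- 1#) ^ i * nat j ^ i)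
      ≈⟨ solve 3 (λ a b c → a :* (b :* c) := b :* (c :* a)) refl _ _ _ ⟩
    (- 1#) ^ i * (nat j ^ i * nat j ^ j)
      ≈⟨ *-cong (-1^complement {i} {j} e) (trans (sym (^-homo-* (nat j) i j)) (trans (^-congʳ (nat j) e) (nat-^p j))) ⟩
    signed j ∎

  hyperfactorial-signed : nat (hyperfactorial (h ℕ.+ h)) ≈ ∏ h signed
  hyperfactorial-signed = begin
    nat (hyperfactorial (h ℕ.+ h))
      ≈⟨ ∏-hyperfactorial (h ℕ.+ h) ⟨
    ∏ (h ℕ.+ h) f
      ≈⟨ ∏-++ h h f ⟩
    ∏ h f * ∏ h (λ i → f (h ℕ.+ i))
      -- `h + suc h ∸ j` is p - j: the upper half of the range is read backwards.
      ≈⟨ *-congˡ (∏-reverse h (λ i → f (h ℕ.+ i)) (λ j → f (h ℕ.+ suc h ℕ.∸ j)) reindex) ⟩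
    ∏ h f * ∏ h (λ j → f (h ℕ.+ suc h ℕ.∸ j))
      ≈⟨ ∏-* h f _ ⟨
    ∏ h (λ j → f j * f (h ℕ.+ suc h ℕ.∸ j))
      ≈⟨ ∏-cong h (λ j _ j≤h → fold-term _ j (≡.trans (ℕₚ.m∸n+n≡m (ℕₚ.≤-trans j≤h (ℕₚ.m≤m+n h (suc h)))) (ℕₚ.+-suc h h))) ⟩
    ∏ h signed ∎
    where
    f : ℕ → Carrier
    f j = nat j ^ j

    reindex : ∀ i j → suc (i ℕ.+ j) ≡ h → f (h ℕ.+ suc i) ≈ f (h ℕ.+ suc h ℕ.∸ suc j)
    reindex i j e = reflexive (≡.cong f (≡.trans (≡.sym (ℕₚ.m+n∸n≡m (h ℕ.+ suc i) (suc j)))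
      (≡.cong (ℕ._∸ suc j) (≡.trans (ℕₚ.+-assoc h (suc i) (suc j))
        (≡.cong (h ℕ.+_) (≡.cong suc (≡.trans (ℕₚ.+-suc i j) e)))))))

  minusTwo : Carrier
  minusTwo = - nat 2

  minusTwo*nat : ∀ j → minusTwo * nat j ≈ - nat (j ℕ.+ j)
  minusTwo*nat j = trans (sym (-‿distribˡ-* (nat 2) (nat j))) (-‿cong (trans (sym (nat-* 2 j))
    (nat-cong (≡.cong (j ℕ.+_) (ℕₚ.+-identityʳ j)))))

  signed-even : ∀ j → signed (j ℕ.+ j) ≈ minusTwo * nat j
  signed-even j = begin
    - 1# * (- 1#) ^ (j ℕ.+ j) * nat (j ℕ.+ j)  ≈⟨ *-congʳ (trans (*-congˡ (-1^[n+n] j)) (*-identityʳ _)) ⟩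
    - 1# * nat (j ℕ.+ j)                       ≈⟨ -1*x _ ⟩
    - nat (j ℕ.+ j)                            ≈⟨ minusTwo*nat j ⟨
    minusTwo * nat j                           ∎

  signed-odd : ∀ j → signed (suc (j ℕ.+ j)) ≈ nat (suc (j ℕ.+ j))
  signed-odd j = trans (*-congʳ (trans (^-congʳ (- 1#) (≡.cong suc (≡.sym (ℕₚ.+-suc j j)))) (-1^[n+n] (suc j)))) (*-identityˡ _)

  odd : ℕ → Carrier
  odd i = nat (i ℕ.+ i ℕ.∸ 1)

  signed-pairs : ∀ m → ∏ (m ℕ.+ m) signed ≈ ∏ m (λ j → minusTwo * nat j) * ∏ m odd
  signed-pairs m = begin
    ∏ (m ℕ.+ m) signed
      ≈⟨ ∏-pairs m signed ⟩
    ∏ m (λ j → signed (j ℕ.+ j ℕ.∸ 1) * signed (j ℕ.+ j))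
      ≈⟨ ∏-cong m (λ j 1≤j _ → trans (*-cong (pred-odd j 1≤j) (signed-even j)) (*-comm _ _)) ⟩
    ∏ m (λ j → minusTwo * nat j * odd j)
      ≈⟨ ∏-* m _ _ ⟩
    ∏ m (λ j → minusTwo * nat j) * ∏ m odd ∎
    where
    pred-odd : ∀ j → 1 ℕ.≤ j → signed (j ℕ.+ j ℕ.∸ 1) ≈ odd j
    pred-odd (suc j) _ rewrite ℕₚ.+-suc j j = signed-odd j

  -- As a set, {-2j : j ≤ h} = {(-1)^{j+1} j : j ≤ h}: -2j is even and negative for j ≤ h/2 and
  -- is congruent to the odd number p - 2j ≤ h for j > h/2.
  doubles : ∀ m n → m ℕ.+ n ≡ h → ∏ h (λ j → minusTwo * nat j) ≈ ∏ m (λ j → minusTwo * nat j) * ∏ n odd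
  doubles m n ≡.refl = trans (∏-++ m n _) (*-congˡ (∏-reverse n _ odd reindex))
    where
    open +-*-Solver using () renaming (solve to solveℕ; _:+_ to _⊕_; _:=_ to _⊜_; con to conℕ)

    reindex : ∀ i j → suc (i ℕ.+ j) ≡ n → minusTwo * nat (m ℕ.+ suc i) ≈ odd (suc j)
    reindex i j ≡.refl = trans (minusTwo*nat (m ℕ.+ suc i)) (sym (nat-complement {j ℕ.+ suc j} total))
      where
      total : j ℕ.+ suc j ℕ.+ (m ℕ.+ suc i ℕ.+ (m ℕ.+ suc i)) ≡ suc (m ℕ.+ suc (i ℕ.+ j) ℕ.+ (m ℕ.+ suc (i ℕ.+ j)))
      total = solveℕ 3 (λ i j m → j ⊕ (conℕ 1 ⊕ j) ⊕ (m ⊕ (conℕ 1 ⊕ i) ⊕ (m ⊕ (conℕ 1 ⊕ i))) ⊜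
        conℕ 1 ⊕ (m ⊕ (conℕ 1 ⊕ (i ⊕ j)) ⊕ (m ⊕ (conℕ 1 ⊕ (i ⊕ j))))) ≡.refl i j m

  -- Both sides split into the -2j with 2j ≤ h and the odd numbers up to h. For odd h there is one
  -- more odd number than there are even ones, whence the cut at m and m + 1.
  signed-doubles : ∏ h signed ≈ ∏ h (λ j → minusTwo * nat j)
  signed-doubles with halves h
  ... | m , inj₁ h≡ = trans (reflexive (≡.cong (λ n → ∏ n signed) h≡))
    (trans (signed-pairs m) (sym (doubles m m (≡.sym h≡))))
  ... | m , inj₂ h≡ = begin
    ∏ h signed
      ≈⟨ reflexive (≡.cong (λ n → ∏ n signed) (≡.trans h≡ (ℕₚ.+-suc m m))) ⟩
    ∏ (m ℕ.+ m) signed * signed (suc (m ℕ.+ m))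
      ≈⟨ *-cong (signed-pairs m) (trans (signed-odd m) (nat-cong (≡.sym (ℕₚ.+-suc m m)))) ⟩
    ∏ m (λ j → minusTwo * nat j) * ∏ m odd * odd (suc m)
      ≈⟨ *-assoc _ _ _ ⟩
    ∏ m (λ j → minusTwo * nat j) * ∏ (suc m) odd
      ≈⟨ doubles m (suc m) (≡.sym h≡) ⟨
    ∏ h (λ j → minusTwo * nat j) ∎

  hyperfactorial-minusTwo : nat (hyperfactorial (h ℕ.+ h)) ≈ minusTwo ^ h * nat (h !)
  hyperfactorial-minusTwo = begin
    nat (hyperfactorial (h ℕ.+ h))     ≈⟨ hyperfactorial-signed ⟩
    ∏ h signed                         ≈⟨ signed-doubles ⟩
    ∏ h (λ j → minusTwo * nat j)       ≈⟨ ∏-* h (λ _ → minusTwo) nat ⟩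
    ∏ h (λ _ → minusTwo) * ∏ h nat     ≈⟨ *-cong (∏-const h minusTwo) (∏-nat h) ⟩
    minusTwo ^ h * nat (h !)           ∎

  integral-cancel : ∀ {x y z} → x * z ≈ y * z → x ≈ y ⊎ z ≈ 0#
  integral-cancel {x} {y} {z} e with integral (x - y) z (begin
    (x - y) * z            ≈⟨ distribʳ z x (- y) ⟩
    x * z + - y * z        ≈⟨ +-cong e (sym (-‿distribˡ-* y z)) ⟩
    y * z + - (y * z)      ≈⟨ -‿inverseʳ _ ⟩
    0#                     ∎)
  ... | inj₁ x-y≈0 = inj₁ (trans (x+y≈0⇒x≈-y x-y≈0) (-‿involutive y))
  ... | inj₂ z≈0   = inj₂ z≈0

  nat≉0 : ∀ {n} → 1 ℕ.≤ n → n ℕ.< p → ¬ (nat n ≈ 0#)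
  nat≉0 1≤n n<p e = 1≉0 (nat-cancel 1≤n n<p (trans (trans (*-congʳ e) (zeroˡ _)) (sym (zeroʳ _))))

  1≤h : 1 ℕ.≤ h
  1≤h = positive 1≤q
    where
    positive : ∀ {n} → 1 ℕ.≤ n ℕ.+ n → 1 ℕ.≤ n
    positive {suc n} _ = ℕ.s≤s ℕ.z≤n

  -- Equal squares would force i = j or i + j = 0 modulo p; the bound h keeps i + j strictly between
  -- 0 and p.
  nat-squares-distinct : ∀ {i j} → 1 ℕ.≤ i → i ℕ.< j → j ℕ.≤ h → ¬ (nat i * nat i ≈ nat j * nat j)
  nat-squares-distinct {i} {j} 1≤i i<j j≤h e with integral-cancel {nat i} {nat j} {nat i + nat j} (begin
    nat i * (nat i + nat j)          ≈⟨ distribˡ _ _ _ ⟩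
    nat i * nat i + nat i * nat j    ≈⟨ +-cong e (*-comm _ _) ⟩
    nat j * nat j + nat j * nat i    ≈⟨ +-comm _ _ ⟩
    nat j * nat i + nat j * nat j    ≈⟨ distribˡ _ _ _ ⟨
    nat j * (nat i + nat j)          ∎)
  ... | inj₁ i≈j = 1≉0 (nat-distinct i<j (ℕ.s≤s (ℕₚ.≤-trans j≤h (ℕₚ.m≤m+n h h))) 1# (*-congʳ i≈j))
  ... | inj₂ i+j≈0 = nat≉0 (ℕₚ.≤-trans 1≤i (ℕₚ.m≤m+n i j))
    (ℕ.s≤s (ℕₚ.+-mono-≤ (ℕₚ.≤-trans (ℕₚ.<⇒≤ i<j) j≤h) j≤h)) (trans (nat-+ i j) i+j≈0)

  euler-residue : ∀ {d m} → m ℕ.< p → nat m * nat m ≈ d → ¬ (d ≈ 0#) → d ^ h ≈ 1#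
  euler-residue {d} {zero}  _   e d≉0 = contradiction (trans (sym e) (zeroˡ _)) d≉0
  euler-residue {d} {suc m} m<p e d≉0 = begin
    d ^ h                                ≈⟨ ^-congˡ h e ⟨
    (nat (suc m) * nat (suc m)) ^ h      ≈⟨ ^-distrib-* _ _ h ⟩
    nat (suc m) ^ h * nat (suc m) ^ h    ≈⟨ ^-homo-* _ h h ⟨
    nat (suc m) ^ (h ℕ.+ h)              ≈⟨ nat-^q (ℕ.s≤s ℕ.z≤n) m<p ⟩
    1#                                   ∎

  -- Otherwise d and the h nonzero squares are h + 1 roots of x^h - 1.
  euler-nonresidue-≉1 : ∀ {d} → (∀ m → m ℕ.< p → ¬ (nat m * nat m ≈ d)) → ¬ (d ^ h ≈ 1#)
  euler-nonresidue-≉1 {d} nonresidue d^h≈1 = 1≉0 (begin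
    1#                    ≈⟨ -‿involutive 1# ⟨
    - (- 1#)              ≈⟨ -‿cong -1≈0 ⟩
    - 0#                  ≈⟨ -0#≈0# ⟩
    0#                    ∎)
    where
    r : ℕ → Carrier
    r zero    = d
    r (suc i) = nat (suc i) * nat (suc i)

    <p : ∀ {j} → j ℕ.≤ h → j ℕ.< p
    <p j≤h = ℕ.s≤s (ℕₚ.≤-trans j≤h (ℕₚ.m≤m+n h h))

    distinct : ∀ {i j} → i ℕ.< j → j ℕ.< suc h → ∀ z → r i * z ≈ r j * z → z ≈ 0#
    distinct {zero} {suc j} _ (ℕ.s≤s j≤h) z e with integral-cancel e
    ... | inj₁ d≈j² = contradiction (sym d≈j²) (nonresidue (suc j) (<p j≤h))
    ... | inj₂ z≈0  = z≈0
    distinct {suc i} {suc j} i<j (ℕ.s≤s j≤h) z e with integral-cancel e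
    ... | inj₁ i²≈j² = contradiction i²≈j² (nat-squares-distinct (ℕ.s≤s ℕ.z≤n) i<j j≤h)
    ... | inj₂ z≈0   = z≈0

    root : ∀ {i} → i ℕ.< suc h → r i ^ h + - 1# ≈ 0#
    root {zero}  _           = trans (+-congʳ d^h≈1) (-‿inverseʳ 1#)
    root {suc i} (ℕ.s≤s i<h) = trans
      (+-congʳ (euler-residue {m = suc i} (<p i<h) refl (i²≉0 ∘ integral _ _))) (-‿inverseʳ 1#)
      where
      i²≉0 : ¬ (nat (suc i) ≈ 0# ⊎ nat (suc i) ≈ 0#)
      i²≉0 (inj₁ e) = nat≉0 (ℕ.s≤s ℕ.z≤n) (<p i<h) e
      i²≉0 (inj₂ e) = nat≉0 (ℕ.s≤s ℕ.z≤n) (<p i<h) e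

    0^h : ∀ {n} → 1 ℕ.≤ n → 0# ^ n ≈ 0#
    0^h (ℕ.s≤s _) = zeroˡ _

    -- With too many roots x^h - 1 vanishes identically; at x = 0, where h ≥ 1 counts, this gives
    -- the contradiction.
    -1≈0 : - 1# ≈ 0#
    -1≈0 = trans (sym (trans (+-congʳ (0^h 1≤h)) (+-identityˡ _)))
      (Deg<-roots (suc h) (Deg<-+ (Deg<-^ h) (Deg<-const h (- 1#))) r distinct root 0#)

  -- By Fermat u = n^h has square 1, so u (u + 1) = 1 (u + 1), and cancellation leaves u = 1 or u =
  -- -1.
  euler-nonresidue : ∀ {n} → 1 ℕ.≤ n → n ℕ.< p → (∀ m → m ℕ.< p → ¬ (nat m * nat m ≈ nat n)) → nat n ^ h ≈ - 1#
  euler-nonresidue {n} 1≤n n<p nonresidue with integral-cancel {u} {1#} {u + 1#} (begin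
    u * (u + 1#)        ≈⟨ distribˡ u u 1# ⟩
    u * u + u * 1#      ≈⟨ +-cong (trans (sym (^-homo-* (nat n) h h)) (nat-^q 1≤n n<p)) (*-identityʳ u) ⟩
    1# + u              ≈⟨ +-comm _ _ ⟩
    u + 1#              ≈⟨ *-identityˡ _ ⟨
    1# * (u + 1#)       ∎)
    where
    u : Carrier
    u = nat n ^ h
  ... | inj₁ u≈1   = contradiction u≈1 (euler-nonresidue-≉1 nonresidue)
  ... | inj₂ u+1≈0 = x+y≈0⇒x≈-y u+1≈0

-- The field ℤ/p and the Legendre symbol

open import Data.Integer as ℤ using (ℤ; +_; _%ℕ_; _/ℕ_)
import Data.Integer.DivMod as ℤ%
import Data.Integer.Properties as ℤₚ
open import Data.Integer.Divisibility using (_∣_)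
import Data.Integer.Divisibility.Signed as Signed

-- sqSearch is private in Defs; the metavariable is solved by unification against an unfolding of
-- legendre in which the modulus and the search bound have become distinct variables.
mutual
  squareSearch : ℕ → ℕ → ℕ → Bool
  squareSearch = _

  legendre-squareSearch : ∀ d q r → d %ℕ suc (suc q) ≡ suc r →
    legendre d (suc (suc q)) ≡
    (if ((suc q ℕ.* suc q) % suc (suc q) ℕ.≡ᵇ suc r) ∨
        (((q ℕ.* q) % suc (suc q) ℕ.≡ᵇ suc r) ∨ squareSearch (suc q) (suc r) q)
     then + 1 else ℤ.- (+ 1))
  legendre-squareSearch d q r eq with d %ℕ suc (suc q)
  legendre-squareSearch d q r ≡.refl | .(suc r) with suc q | suc r
  ... | Q | R = ≡.refl

squareSearch-true : ∀ q r n → squareSearch q r n ≡ true → ∃ λ m → m ℕ.< n × (m ℕ.* m) % suc q ≡ r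
squareSearch-true q r (suc n) e with (n ℕ.* n) % suc q ℕ.≡ᵇ r in eq
... | true  = n , ℕₚ.n<1+n n , ℕₚ.≡ᵇ⇒≡ _ r (≡.subst T (≡.sym eq) _)
... | false with squareSearch-true q r n e
...   | m , m<n , m²≡r = m , ℕₚ.m<n⇒m<1+n m<n , m²≡r

squareSearch-false : ∀ q r n → squareSearch q r n ≡ false → ∀ m → m ℕ.< n → (m ℕ.* m) % suc q ≢ r
squareSearch-false q r (suc n) e m m<1+n m²≡r with (n ℕ.* n) % suc q ℕ.≡ᵇ r in eq
... | false with ℕₚ.m≤n⇒m<n∨m≡n (ℕₚ.≤-pred m<1+n)
...   | inj₁ m<n    = squareSearch-false q r n e m m<n m²≡r
...   | inj₂ ≡.refl = ≡.subst T eq (ℕₚ.≡⇒≡ᵇ _ r m²≡r)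

module ResidueField (q : ℕ) (p-prime : Prime (suc q)) where
  private
    p : ℕ
    p = suc q

  open PrincipalQuotient ℤₚ.+-*-commutativeRing (+ p) public using (quotientRing; mod)
  open RingLemmas quotientRing public

  nat≡+ : ∀ n → nat n ≡ + n
  nat≡+ zero    = ≡.refl
  nat≡+ (suc n) = ≡.cong (λ z → 1# + z) (nat≡+ n)

  nat≈+ : ∀ n → nat n ≈ + n
  nat≈+ n = reflexive (nat≡+ n)

  ≈⇒∣ : ∀ {x y} → x ≈ y → (+ p) ∣ (x ℤ.- y)
  ≈⇒∣ {x} {y} (mod k e) = Signed.∣⇒∣ᵤ (Signed.divides k (≡.trans (≡.cong (ℤ._- y) e)
    (≡.trans (≡.cong (ℤ._- y) (ℤₚ.+-comm y _)) (≡.trans (ℤₚ.+-assoc (k ℤ.* (+ p)) y (ℤ.- y))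
      (≡.trans (≡.cong (λ z → k ℤ.* (+ p) ℤ.+ z) (ℤₚ.+-inverseʳ y)) (ℤₚ.+-identityʳ _))))))

  ∣⇒≈ : ∀ {x y} → (+ p) ∣ (x ℤ.- y) → x ≈ y
  ∣⇒≈ {x} {y} d with Signed.∣ᵤ⇒∣ {+ p} {x ℤ.- y} d
  ... | Signed.divides k e = mod k (≡.trans (≡.sym (ℤₚ.+-identityʳ x)) (≡.trans
    (≡.cong (λ z → x ℤ.+ z) (≡.sym (ℤₚ.+-inverseˡ y))) (≡.trans (≡.sym (ℤₚ.+-assoc x (ℤ.- y) y))
      (≡.trans (≡.cong (ℤ._+ y) e) (ℤₚ.+-comm _ y)))))

  ≈0⇒∣ : ∀ {x} → x ≈ 0# → p ℕ∣.∣ ℤ.∣ x ∣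
  ≈0⇒∣ {x} e = ≡.subst (λ y → p ℕ∣.∣ ℤ.∣ y ∣) (ℤₚ.+-identityʳ x) (≈⇒∣ e)

  ∣⇒≈0 : ∀ {x} → p ℕ∣.∣ ℤ.∣ x ∣ → x ≈ 0#
  ∣⇒≈0 {x} d = ∣⇒≈ (≡.subst (λ y → p ℕ∣.∣ ℤ.∣ y ∣) (≡.sym (ℤₚ.+-identityʳ x)) d)

  ≈0? : DecidableZero
  ≈0? x = map′ ∣⇒≈0 ≈0⇒∣ (p ℕ∣.∣? ℤ.∣ x ∣)

  integral : NoZeroDivisors
  integral x y e with euclidsLemma ℤ.∣ x ∣ ℤ.∣ y ∣ p-prime (≡.subst (p ℕ∣.∣_) (ℤₚ.abs-* x y) (≈0⇒∣ e))
  ... | inj₁ p∣x = inj₁ (∣⇒≈0 p∣x)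
  ... | inj₂ p∣y = inj₂ (∣⇒≈0 p∣y)

  1≉0 : Nontrivial
  1≉0 e = ¬prime[1] (≡.subst Prime (ℕ∣.∣1⇒≡1 (≈0⇒∣ e)) p-prime)

  char : HasCharacteristic p
  char = trans (nat≈+ p) (∣⇒≈0 ℕ∣.∣-refl)

  bell≈hyperfactorial : ∀ {x a} → 1 ℕ.≤ a → nat (a ℕ.* x) ≈ 1# → nat (bell (tau p a) x) ≈ nat (hyperfactorial q)
  bell≈hyperfactorial = BellModP.bell-tau isPolynomialExtension q p-prime char
    where
    open PolynomialDegree quotientRing ≈0? integral 1≉0 using (isPolynomialExtension)

module LegendreSymbol (h : ℕ) (p-prime : Prime (suc (suc h ℕ.+ suc h))) where
  private
    q p : ℕ
    q = suc h ℕ.+ suc h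
    p = suc q

  open ResidueField q p-prime
  open CharP quotientRing q p-prime char using (nat-distinct; nat-∣)
  open OddPrimeField quotientRing integral 1≉0 (suc h) p-prime char

  nat-% : ∀ n → nat n ≈ nat (n % p)
  nat-% n = begin
    nat n                                    ≈⟨ nat-cong (m≡m%n+[m/n]*n n p) ⟩
    nat (n % p ℕ.+ (n / p) ℕ.* p)            ≈⟨ nat-+ (n % p) ((n / p) ℕ.* p) ⟩
    nat (n % p) + nat ((n / p) ℕ.* p)        ≈⟨ +-congˡ {nat (n % p)} (nat-∣ (ℕ∣.n∣m*n (n / p))) ⟩
    nat (n % p) + 0#                         ≈⟨ +-identityʳ _ ⟩
    nat (n % p)                              ∎

  -- The search behind `legendre` compares remainders as natural numbers, so congruences of reduced
  -- residues have to become equalities.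
  nat-injective : ∀ {i j} → i ℕ.< p → j ℕ.< p → nat i ≈ nat j → i ≡ j
  nat-injective {i} {j} i<p j<p e with ℕₚ.<-cmp i j
  ... | tri< i<j _ _ = contradiction (nat-distinct i<j j<p 1# (*-congʳ e)) 1≉0
  ... | tri≈ _ i≡j _ = i≡j
  ... | tri> _ _ j<i = contradiction (nat-distinct j<i i<p 1# (*-congʳ (sym e))) 1≉0

  square-≈⇒% : ∀ {m r} → r ℕ.< p → nat m * nat m ≈ nat r → (m ℕ.* m) % p ≡ r
  square-≈⇒% {m} {r} r<p e = nat-injective (m%n<n (m ℕ.* m) p) r<p
    (trans (sym (nat-% (m ℕ.* m))) (trans (nat-* m m) e))

  square-%⇒≈ : ∀ {m r} → (m ℕ.* m) % p ≡ r → nat m * nat m ≈ nat r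
  square-%⇒≈ {m} e = trans (sym (nat-* m m)) (trans (nat-% (m ℕ.* m)) (nat-cong e))

  ≈%ℕ : ∀ d → d ≈ nat (d %ℕ p)
  ≈%ℕ d = trans (mod (d /ℕ p) (ℤ%.a≡a%ℕn+[a/ℕn]*n d p)) (sym (nat≈+ (d %ℕ p)))

  euler : ∀ r → suc r ℕ.< p → (if squareSearch q (suc r) p then + 1 else - (+ 1)) ≈ nat (suc r) ^ suc h
  euler r r<p = by-search (squareSearch q (suc r) p) ≡.refl
    where
    by-search : ∀ b → squareSearch q (suc r) p ≡ b → (if b then + 1 else - (+ 1)) ≈ nat (suc r) ^ suc h
    by-search true e with squareSearch-true q (suc r) p e
    ... | m , m<p , m² = sym (euler-residue m<p (square-%⇒≈ {m} m²) (nat≉0 (ℕ.s≤s ℕ.z≤n) r<p))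
    by-search false e = sym (euler-nonresidue (ℕ.s≤s ℕ.z≤n) r<p λ m m<p m²≈r →
      squareSearch-false q (suc r) p e m m<p (square-≈⇒% {m} r<p m²≈r))

  -- Euler's criterion for an integer d, reduced to its residue `d %ℕ p`, on which the search
  -- operates.
  legendre≈^ : ∀ d → ¬ (d ≈ 0#) → legendre d p ≈ d ^ suc h
  legendre≈^ d d≉0 = by-residue (d %ℕ p) ≡.refl
    where
    by-residue : ∀ r → d %ℕ p ≡ r → legendre d p ≈ d ^ suc h
    by-residue zero    e = contradiction (trans (≈%ℕ d) (nat-cong e)) d≉0
    by-residue (suc r) e = begin
      legendre d p
        ≈⟨ reflexive (legendre-squareSearch d (h ℕ.+ suc h) r e) ⟩
      (if squareSearch q (suc r) p then + 1 else - (+ 1))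
        ≈⟨ euler r (≡.subst (ℕ._< p) e (ℤ%.n%ℕd<d d p)) ⟩
      nat (suc r) ^ suc h
        ≈⟨ ^-congˡ (suc h) (trans (≈%ℕ d) (nat-cong e)) ⟨
      d ^ suc h ∎

  minusTwo≉0 : ¬ (minusTwo ≈ 0#)
  minusTwo≉0 e = nat≉0 {2} (ℕ.s≤s ℕ.z≤n) (ℕ.s≤s (ℕ.s≤s (ℕₚ.≤-trans (ℕ.s≤s ℕ.z≤n) (ℕₚ.m≤n+m (suc h) h))))
    (trans (sym (-‿involutive (nat 2))) (trans (-‿cong e) -0#≈0#))

  bell-tau≈legendre : ∀ {x a} → 1 ℕ.≤ a → nat (a ℕ.* x) ≈ 1# →
    + bell (tau p a) x ≈ legendre (- (+ 2)) p * (+ (suc h !))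
  bell-tau≈legendre {x} {a} 1≤a ax≈1 = begin
    + bell (tau p a) x                          ≈⟨ nat≈+ _ ⟨
    nat (bell (tau p a) x)                      ≈⟨ bell≈hyperfactorial {x} {a} 1≤a ax≈1 ⟩
    nat (hyperfactorial q)                      ≈⟨ hyperfactorial-minusTwo ⟩
    minusTwo ^ suc h * nat (suc h !)            ≈⟨ *-cong (legendre≈^ minusTwo minusTwo≉0) (sym (nat≈+ (suc h !))) ⟨
    legendre (- (+ 2)) p * (+ (suc h !))        ∎

-- Conclusion for an odd prime

odd-prime : ∀ {p} → Prime p → p ≢ 2 → ∃ λ h → p ≡ suc (suc h ℕ.+ suc h)
odd-prime {zero}  pp _   = contradiction pp ¬prime[0]
odd-prime {suc q} pp p≢2 with halves q
... | zero  , inj₁ ≡.refl = contradiction pp ¬prime[1]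
... | suc h , inj₁ ≡.refl = h , ≡.refl
-- In this case p = 2 (h + 1) is even, and irreducibility leaves only p = 2.
... | h     , inj₂ ≡.refl with prime⇒irreducible pp (divides {2} (suc h) 2∣p)
  where
  2∣p : suc (h ℕ.+ suc h) ≡ suc h ℕ.* 2
  2∣p = ≡.trans (≡.cong (suc h ℕ.+_) (≡.sym (ℕₚ.+-identityʳ (suc h)))) (ℕₚ.*-comm 2 (suc h))
...   | inj₁ ()
...   | inj₂ 2≡p = contradiction (≡.sym 2≡p) p≢2

open import Data.Nat using (_*_; _∸_; _≥_)
open import Data.Integer using (-_)

theorem4p1 : (p a : ℕ) → Prime p → p ≢ 2 → a ≥ 1 → gcd a p ≡ 1 →
    (ainv : ℕ) → (+ p) ∣ ((+ (a * ainv)) ℤ.- (+ 1)) →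
    (+ p) ∣ ((+ bell (tau p a) ainv) ℤ.- (legendre (- (+ 2)) p ℤ.* (+ (((p ∸ 1) / 2) !))))
theorem4p1 p a pp p≢2 a≥1 _ ainv p∣aa⁻¹-1 with odd-prime pp p≢2
... | h , ≡.refl = ≡.subst (λ n → (+ p) ∣ ((+ bell (tau p a) ainv) ℤ.- (legendre (- (+ 2)) p ℤ.* (+ (n !)))))
  (≡.sym half) (≈⇒∣ (bell-tau≈legendre a≥1 (trans (nat≈+ (a * ainv)) (∣⇒≈ p∣aa⁻¹-1))))
  where
  open LegendreSymbol h pp
  open ResidueField (suc h ℕ.+ suc h) pp using (≈⇒∣; ∣⇒≈; nat≈+; trans)

  half : (suc h ℕ.+ suc h) / 2 ≡ suc h
  half = ≡.trans (≡.cong (_/ 2) (≡.trans (≡.cong (suc h ℕ.+_) (≡.sym (ℕₚ.+-identityʳ (suc h)))) (ℕₚ.*-comm 2 (suc h))))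
    (m*n/n≡m (suc h) 2)
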